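{- Let $(W,S)$ be a Coxeter system with $|S|<\infty$ and let $G$ be a group of automorphisms of $W$ each of which preserves $S$. Let $W^G$ be the subgroup of $G$-fixed elements and $(\widetilde W,\widetilde S)$, $\phi$ as in the context. Then the subposet of the Bruhat order $\mathrm{Br}(W)$ induced by $W^G$ is isomorphic to the Bruhat order $\mathrm{Br}(\widetilde W)$.
   Context: Bruhat order on a Coxeter group: $v\le w$ iff some reduced expression of $w$ contains a subexpression that is a reduced expression of $v$. For $J\subseteq S$ with $W_J=\langle J\rangle$ finite, $w_0(J)$ is the longest element of $W_J$. Let $\widetilde S=\{\widetilde s_J\mid J\subseteq S\text{ is a }G\text{ -orbit and }W_J\text{ finite}\}$. By a known theorem (H\'ee, M\"uhlherr, Steinberg), with suitable Coxeter relations $\widetilde S$ generates a Coxeter system $(\widetilde W,\widetilde S)$ such that $\widetilde s_J\mapsto w_0(J)$ defines an injective group homomorphism $\phi:\widetilde W\to W$ with image $W^G$; in particular $W^G\cong\widetilde W$. -}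

module Defs where

open import Level using (0ℓ)
open import Data.Nat using (ℕ; zero; suc; _≤_)
open import Data.Fin using (Fin)
open import Data.Fin.Subset using (Subset) renaming (_∈_ to _∈ₛ_)
open import Data.List using (List; []; _∷_; _++_; length; concatMap)
open import Data.List.Relation.Unary.All using (All)
open import Data.List.Relation.Binary.Sublist.Propositional using (_⊆_)
open import Data.List.Membership.Propositional using (_∈_)
open import Data.Product using (Σ; ∃; _×_; _,_)
open import Function.Bundles using (_⇔_)
open import Relation.Binary.PropositionalEquality using (_≡_; _≢_)
open import Relation.Binary.Construct.Closure.Equivalence using (EqClosure)

-- Coxeter matrices on the finite generating set S = Fin n.
-- Convention: m i j ≡ 0 encodes m(s,t) = ∞.

record CoxeterMatrix (n : ℕ) : Set where
  field
    m       : Fin n → Fin n → ℕ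
    diag    : ∀ i → m i i ≡ 1
    symm    : ∀ i j → m i j ≡ m j i
    offdiag : ∀ i j → i ≢ j → m i j ≢ 1

Word : ℕ → Set
Word n = List (Fin n)

alt : ∀ {n} → Fin n → Fin n → ℕ → Word n
alt s t zero    = []
alt s t (suc k) = s ∷ alt t s k

data Step {n} (M : CoxeterMatrix n) : Word n → Word n → Set where
  cancel : ∀ u v s → Step M (u ++ (s ∷ s ∷ v)) (u ++ v)
  braid  : ∀ u v s t → CoxeterMatrix.m M s t ≢ 0 →
           Step M (u ++ (alt s t (CoxeterMatrix.m M s t) ++ v))
                  (u ++ (alt t s (CoxeterMatrix.m M s t) ++ v))

-- The Coxeter group W(M) is Word n modulo this congruence
-- (the group with presentation < S | s² = 1, (st)^m(s,t) = 1 >).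
_≈⟨_⟩_ : ∀ {n} → Word n → CoxeterMatrix n → Word n → Set
u ≈⟨ M ⟩ v = EqClosure (Step M) u v

IsReduced : ∀ {n} → CoxeterMatrix n → Word n → Set
IsReduced M u = ∀ v → v ≈⟨ M ⟩ u → length u ≤ length v

Bruhat : ∀ {n} → CoxeterMatrix n → Word n → Word n → Set
Bruhat M v w =
  ∃ λ u → u ≈⟨ M ⟩ w × IsReduced M u ×
  ∃ λ u' → u' ⊆ u × IsReduced M u' × u' ≈⟨ M ⟩ v

record Automorphism {n} (M : CoxeterMatrix n) : Set where
  field
    fun    : Word n → Word n
    inv    : Word n → Word n
    fun-cong : ∀ {u v} → u ≈⟨ M ⟩ v → fun u ≈⟨ M ⟩ fun v
    inv-cong : ∀ {u v} → u ≈⟨ M ⟩ v → inv u ≈⟨ M ⟩ inv v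
    fun-hom  : ∀ u v → fun (u ++ v) ≈⟨ M ⟩ (fun u ++ fun v)
    fun-inv  : ∀ u → fun (inv u) ≈⟨ M ⟩ u
    inv-fun  : ∀ u → inv (fun u) ≈⟨ M ⟩ u
    fun-S    : ∀ i → ∃ λ j → fun (i ∷ []) ≈⟨ M ⟩ (j ∷ [])
    inv-S    : ∀ i → ∃ λ j → inv (i ∷ []) ≈⟨ M ⟩ (j ∷ [])

open Automorphism public

record AutGroup {n} (M : CoxeterMatrix n) : Set₁ where
  field
    Mem    : Automorphism M → Set
    has-id : ∃ λ h → Mem h × (∀ u → fun h u ≈⟨ M ⟩ u)
    comp   : ∀ h₁ h₂ → Mem h₁ → Mem h₂ →
             ∃ λ h → Mem h × (∀ u → fun h u ≈⟨ M ⟩ fun h₁ (fun h₂ u))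
    inverse : ∀ h → Mem h → ∃ λ h' → Mem h' × (∀ u → fun h' u ≈⟨ M ⟩ inv h u)

open AutGroup public

IsFixed : ∀ {n} {M : CoxeterMatrix n} → AutGroup M → Word n → Set
IsFixed {M = M} G w = ∀ h → Mem G h → fun h w ≈⟨ M ⟩ w

IsOrbit : ∀ {n} {M : CoxeterMatrix n} → AutGroup M → Subset n → Set
IsOrbit {M = M} G J =
  ∃ λ i → ∀ j → (j ∈ₛ J) ⇔ (∃ λ h → Mem G h × fun h (i ∷ []) ≈⟨ M ⟩ (j ∷ []))

OverJ : ∀ {n} → Subset n → Word n → Set
OverJ J u = All (λ s → s ∈ₛ J) u

FiniteParabolic : ∀ {n} → CoxeterMatrix n → Subset n → Set
FiniteParabolic {n} M J =
  ∃ λ (L : List (Word n)) → ∀ u → OverJ J u → ∃ λ v → v ∈ L × v ≈⟨ M ⟩ u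

IsLongest : ∀ {n} → CoxeterMatrix n → Subset n → Word n → Set
IsLongest M J w =
  OverJ J w × IsReduced M w ×
  (∀ u → OverJ J u → ∃ λ u' → u' ≈⟨ M ⟩ u × length u' ≤ length w)

-- The data (W̃, S̃, φ) of the Hée–Mühlherr–Steinberg theorem.
-- S̃ = Fin k, enumerating the G-orbits J with W_J finite;
-- φ(s̃_J) = w₀(J), extended multiplicatively.

record TildeData {n} (M : CoxeterMatrix n) (G : AutGroup M) : Set where
  field
    k        : ℕ
    orb      : Fin k → Subset n
    orb-orbit  : ∀ a → IsOrbit G (orb a)
    orb-finite : ∀ a → FiniteParabolic M (orb a)
    orb-inj    : ∀ a b → orb a ≡ orb b → a ≡ b
    orb-all    : ∀ J → IsOrbit G J → FiniteParabolic M J → ∃ λ a → orb a ≡ J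
    w₀         : Fin k → Word n
    w₀-longest : ∀ a → IsLongest M (orb a) (w₀ a)
    M̃          : CoxeterMatrix k
  φ : Word k → Word n
  φ u = concatMap w₀ u
  field
    φ-cong  : ∀ u v → u ≈⟨ M̃ ⟩ v → φ u ≈⟨ M ⟩ φ v
    φ-inj   : ∀ u v → φ u ≈⟨ M ⟩ φ v → u ≈⟨ M̃ ⟩ v
    φ-image : ∀ w → IsFixed G w ⇔ (∃ λ u → φ u ≈⟨ M ⟩ w)

open TildeData public

BruhatIso : ∀ {n k} (M : CoxeterMatrix n) (G : AutGroup M) (M̃ : CoxeterMatrix k) → Set
BruhatIso {n} {k} M G M̃ =
  ∃ λ (F : Word k → Word n) →
    (∀ u → IsFixed G (F u)) ×
    (∀ u v → u ≈⟨ M̃ ⟩ v → F u ≈⟨ M ⟩ F v) ×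
    (∀ u v → F u ≈⟨ M ⟩ F v → u ≈⟨ M̃ ⟩ v) ×
    (∀ w → IsFixed G w → ∃ λ u → F u ≈⟨ M ⟩ w) ×
    (∀ u v → Bruhat M̃ u v ⇔ Bruhat M (F u) (F v))

{-# OPTIONS --safe #-}
-- The isomorphism is φ.  The finite parabolic W_J of a G-orbit J either has all of J or
-- none of J among the left descents of a G-fixed element w; in the first case w splits as
-- w₀(J) w' with lengths adding.  Hence φ sends reduced words to reduced words, and the
-- lifting property of the Bruhat order of W, applied along all letters of w₀(J), strips a
-- letter of W̃ from both sides of a comparison of φ-images.
--
-- Constructively, the exchange condition comes from counting reflections modulo 2; this
-- is only a double negation, because the word problem is not solved beforehand.  That
-- m(s,t) is the exact order of s t is shown by a numbers-game representation whose
-- values are functions on a graph: the coefficient 2 cos (π / m) is replaced by the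
-- adjacency operator of disjoint paths with m - 1 vertices, so that no real numbers are
-- needed.  Then the left descents of a reduced word can be computed, which makes
-- reducedness and equality in the group decidable.
module Submission where

open import Defs hiding (_≈⟨_⟩_; k)

open import Data.Bool using (Bool; true; false; not; if_then_else_)
import Data.Bool.Properties as Bool
open import Data.Empty using (⊥)
open import Data.Fin using (Fin; zero; suc; _≟_)
open import Data.Fin.Subset using (Subset; inside; outside) renaming (_∈_ to _∈ₛ_)
open import Data.Integer as ℤ using (ℤ; 0ℤ; 1ℤ)
import Data.Integer.Properties as ℤ
import Data.Integer.Tactic.RingSolver as ℤ-Solver
open import Data.List using (List; []; _∷_; [_]; _++_; length; reverse; map; allFin; cartesianProductWith)
open import Data.List.Membership.Propositional using (_∈_)
open import Data.List.Membership.Propositional.Properties using (∈-allFin; ∈-cartesianProductWith⁺)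
open import Data.List.Properties using
  (++-assoc; ++-identityʳ; length-++; map-++; map-id; map-∘; unfold-reverse; reverse-++;
  reverse-involutive)
open import Data.List.Relation.Binary.Sublist.Propositional using
  (_⊆_; []; _∷_; _∷ʳ_; ⊆-refl; ⊆-trans; minimum)
open import Data.List.Relation.Binary.Sublist.Propositional.Properties using (All-resp-⊆; ++⁺)
open import Data.List.Relation.Unary.All as All using (All; []; _∷_)
import Data.List.Relation.Unary.All.Properties as All
open import Data.List.Relation.Unary.Any as Any using (Any; here; there)
import Data.List.Relation.Unary.Any.Properties as Any
open import Data.Nat using (ℕ; zero; suc; _+_; _*_; _∸_; _≤_; _<_; z≤n; s≤s; s<s; _/_; _%_; _≤?_) renaming (_≟_ to _≟ℕ_)
open import Data.Nat.DivMod using (m≡m%n+[m/n]*n; m%n<n)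
open import Data.Nat.Divisibility using (_∣_; _∤_; _∣?_; _∣0; ∣-refl; 0∣⇒≡0; >⇒∤; n∣m*n; ∣m∣n⇒∣m+n; ∣m+n∣m⇒∣n)
open import Data.Nat.Properties using
  (+-cancelˡ-≤; +-comm; +-identityʳ; +-monoʳ-<; +-monoʳ-≤; +-monoˡ-≤; +-suc; <-trans; <⇒≤; <⇒≱;
  m<n⇒m<1+n; m≤m+n; m≤n⇒m<n∨m≡n; n<1+n; n≤1+n; suc-injective; ≤-antisym; ≤-pred; ≤-refl;
  ≤-reflexive; ≤-trans; ≤∧≢⇒<; ≰⇒>)
import Data.Nat.Tactic.RingSolver as ℕ-Solver
open import Data.Product using (∃; ∃₂; _×_; _,_; proj₁; proj₂)
open import Data.Sum as Sum using (_⊎_; inj₁; inj₂; [_,_]′)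
open import Data.Vec using ([]; _∷_; here; there)
open import Function using (_∘_)
open import Function.Bundles using (_⇔_; mk⇔; Equivalence)
open import Relation.Binary.Bundles using (Setoid)
import Relation.Binary.Construct.Closure.Equivalence as EqC
open import Relation.Binary.PropositionalEquality using
  (_≡_; _≢_; _≗_; refl; sym; trans; cong; cong₂; subst; subst₂; ≢-sym; module ≡-Reasoning)
import Relation.Binary.PropositionalEquality.Properties as ≡
import Relation.Binary.Reasoning.Setoid as SetoidReasoning
open import Relation.Binary.Structures using (IsEquivalence)
open import Relation.Nullary using (¬_; Dec; does; yes; no; contradiction)
open import Relation.Nullary.Decidable using
  (dec-true; dec-false; decidable-stable; ¬¬-excluded-middle; map′; _⊎-dec_)

-- Alternating words and parity

-- The letter that continues `alt s t k`; for positive `k`, the last letter of `alt s t k` itself is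
-- `letter t s k`.
letter : ∀ {n} → Fin n → Fin n → ℕ → Fin n
letter s t zero    = s
letter s t (suc k) = letter t s k

alt-+ : ∀ {n} (s t : Fin n) j k →
        alt s t (j + k) ≡ alt s t j ++ alt (letter s t j) (letter t s j) k
alt-+ s t zero    k = refl
alt-+ s t (suc j) k = cong (s ∷_) (alt-+ t s j k)

alt-∷ʳ : ∀ {n} (s t : Fin n) k → alt s t (suc k) ≡ alt s t k ++ [ letter s t k ]
alt-∷ʳ s t zero    = refl
alt-∷ʳ s t (suc k) = cong (s ∷_) (alt-∷ʳ t s k)

alt-∷ʳ-++ : ∀ {n} (s t : Fin n) k w → alt s t k ++ letter s t k ∷ w ≡ alt s t (suc k) ++ w
alt-∷ʳ-++ s t zero    w = refl
alt-∷ʳ-++ s t (suc k) w = cong (s ∷_) (alt-∷ʳ-++ t s k w)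

length-alt-++ : ∀ {n} (s t : Fin n) k w → length (alt s t k ++ w) ≡ k + length w
length-alt-++ s t zero    w = refl
length-alt-++ s t (suc k) w = cong suc (length-alt-++ t s k w)

letter-letter : ∀ {n} (s t : Fin n) k → letter (letter s t k) (letter t s k) k ≡ s
letter-letter s t zero    = refl
letter-letter s t (suc k) = letter-letter s t k

reverse-alt : ∀ {n} (s t : Fin n) k →
              reverse (alt s t k) ≡ alt (letter t s k) (letter s t k) k
reverse-alt s t zero    = refl
reverse-alt s t (suc k) = begin
  reverse (s ∷ alt t s k)                        ≡⟨ unfold-reverse s (alt t s k) ⟩
  reverse (alt t s k) ++ [ s ]                   ≡⟨ cong₂ (λ w x → w ++ [ x ]) (reverse-alt t s k) (sym (letter-letter s t k)) ⟩
  alt p q k ++ [ letter p q k ]                  ≡⟨ alt-∷ʳ p q k ⟨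
  alt p q (suc k)                                ∎
  where
  open ≡-Reasoning
  p = letter s t k
  q = letter t s k

letter-odd : ∀ {n} (s t : Fin n) k → letter s t (suc (k + k)) ≡ t
letter-odd s t zero    = refl
letter-odd s t (suc k) = trans (cong (letter s t) (+-suc k k)) (letter-odd s t k)

reverse-alt-odd : ∀ {n} (s t : Fin n) k → reverse (alt s t (suc (k + k))) ≡ alt s t (suc (k + k))
reverse-alt-odd s t k = trans (reverse-alt s t (suc (k + k)))
  (cong₂ (λ p q → alt p q (suc (k + k))) (letter-odd t s k) (letter-odd s t k))

-- The left side is the power `(s t)^k` and the reversed factor is the inverse of `alt t s k`. So
-- equality of the two alternating words of length `k` can be traded for `(s t)^k = 1`.
alt-double : ∀ {n} (s t : Fin n) k → alt s t (k + k) ≡ alt s t k ++ reverse (alt t s k)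
alt-double s t k = trans (alt-+ s t k k) (cong (alt s t k ++_) (sym (reverse-alt t s k)))

alt-conj : ∀ {n} (s t : Fin n) k →
           s ∷ alt t s (suc (k + k)) ++ [ s ] ≡ alt s t (suc (suc k + suc k))
alt-conj s t k = cong (s ∷_) (begin
  alt t s (suc (k + k)) ++ [ s ]  ≡⟨ cong (λ x → alt t s (suc (k + k)) ++ [ x ]) (letter-odd t s k) ⟨
  alt t s (suc (k + k)) ++ [ letter t s (suc (k + k)) ]  ≡⟨ alt-∷ʳ t s (suc (k + k)) ⟨
  alt t s (suc (suc (k + k)))     ≡⟨ cong (alt t s) (cong suc (sym (+-suc k k))) ⟩
  alt t s (suc k + suc k)         ∎)
  where open ≡-Reasoning

parity : ∀ {n} → Word n → Bool
parity []      = false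
parity (s ∷ w) = not (parity w)

-- The Coxeter group as words modulo the relations

module Words {n} (M : CoxeterMatrix n) where
  open CoxeterMatrix M public using (m)

  infix 4 _≈_
  _≈_ : Word n → Word n → Set
  u ≈ v = EqC.EqClosure (Step M) u v

  Reduced : Word n → Set
  Reduced = IsReduced M

  ≈-setoid : Setoid _ _
  ≈-setoid = EqC.setoid (Step M)

  open IsEquivalence (EqC.isEquivalence (Step M)) public
    using () renaming (refl to ≈-refl; sym to ≈-sym; trans to ≈-trans; reflexive to ≈-reflexive)

  module ≈-Reasoning = SetoidReasoning ≈-setoid

  ++-congˡ : ∀ w {u v} → u ≈ v → w ++ u ≈ w ++ v
  ++-congˡ w = EqC.gmap (w ++_) step
    where
    step : ∀ {u v} → Step M u v → Step M (w ++ u) (w ++ v)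
    step (cancel u v s)    = subst₂ (Step M) (++-assoc w u _) (++-assoc w u v) (cancel (w ++ u) v s)
    step (braid u v s t p) = subst₂ (Step M) (++-assoc w u _) (++-assoc w u _) (braid (w ++ u) v s t p)

  ++-congʳ : ∀ w {u v} → u ≈ v → u ++ w ≈ v ++ w
  ++-congʳ w = EqC.gmap (_++ w) step
    where
    step : ∀ {u v} → Step M u v → Step M (u ++ w) (v ++ w)
    step (cancel u v s)    = subst₂ (Step M) (sym (++-assoc u _ w)) (sym (++-assoc u v w)) (cancel u (v ++ w) s)
    step (braid u v s t p) = subst₂ (Step M) (assoc₃ (alt s t (m s t))) (assoc₃ (alt t s (m s t))) (braid u (v ++ w) s t p)
      where
      assoc₃ : ∀ x → u ++ (x ++ (v ++ w)) ≡ (u ++ (x ++ v)) ++ w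
      assoc₃ x = sym (trans (++-assoc u _ w) (cong (u ++_) (++-assoc x v w)))

  ++-cong : ∀ {u u' v v'} → u ≈ u' → v ≈ v' → u ++ v ≈ u' ++ v'
  ++-cong {u} {u'} {v} {v'} p q = ≈-trans (++-congʳ v p) (++-congˡ u' q)

  ∷-cong : ∀ s {u v} → u ≈ v → s ∷ u ≈ s ∷ v
  ∷-cong s = ++-congˡ [ s ]

  ∷-∷-cancel : ∀ s w → s ∷ s ∷ w ≈ w
  ∷-∷-cancel s w = EqC.return (cancel [] w s)

  alt-braid : ∀ s t → m s t ≢ 0 → alt s t (m s t) ≈ alt t s (m s t)
  alt-braid s t p = subst₂ _≈_ (++-identityʳ _) (++-identityʳ _) (EqC.return (braid [] [] s t p))

  ∷-flip : ∀ s {u v} → s ∷ u ≈ v → u ≈ s ∷ v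
  ∷-flip s {u} p = ≈-trans (≈-sym (∷-∷-cancel s u)) (∷-cong s p)

  ∷-cancel : ∀ s {u v} → s ∷ u ≈ s ∷ v → u ≈ v
  ∷-cancel s {v = v} p = ≈-trans (∷-flip s p) (∷-∷-cancel s v)

  ++-cancelˡ : ∀ w {u v} → w ++ u ≈ w ++ v → u ≈ v
  ++-cancelˡ []      p = p
  ++-cancelˡ (s ∷ w) p = ++-cancelˡ w (∷-cancel s p)

  inverseˡ : ∀ w v → reverse w ++ w ++ v ≈ v
  inverseˡ []      v = ≈-refl
  inverseˡ (s ∷ w) v = begin
    reverse (s ∷ w) ++ s ∷ w ++ v      ≡⟨ cong (_++ s ∷ w ++ v) (unfold-reverse s w) ⟩
    (reverse w ++ [ s ]) ++ s ∷ w ++ v ≡⟨ ++-assoc (reverse w) [ s ] _ ⟩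
    reverse w ++ s ∷ s ∷ w ++ v        ≈⟨ ++-congˡ (reverse w) (∷-∷-cancel s (w ++ v)) ⟩
    reverse w ++ w ++ v                ≈⟨ inverseˡ w v ⟩
    v                                  ∎
    where open ≈-Reasoning

  inverseʳ : ∀ w v → w ++ reverse w ++ v ≈ v
  inverseʳ []      v = ≈-refl
  inverseʳ (s ∷ w) v = begin
    s ∷ w ++ reverse (s ∷ w) ++ v        ≡⟨ cong (λ x → s ∷ w ++ x ++ v) (unfold-reverse s w) ⟩
    s ∷ w ++ (reverse w ++ [ s ]) ++ v   ≡⟨ cong (λ x → s ∷ w ++ x) (++-assoc (reverse w) [ s ] v) ⟩
    s ∷ w ++ reverse w ++ s ∷ v          ≈⟨ ∷-cong s (inverseʳ w (s ∷ v)) ⟩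
    s ∷ s ∷ v                            ≈⟨ ∷-∷-cancel s v ⟩
    v                                    ∎
    where open ≈-Reasoning

  ++-reverse⇒≈ : ∀ u v → u ++ reverse v ≈ [] → u ≈ v
  ++-reverse⇒≈ u v p = begin
    u                       ≡⟨ ++-identityʳ u ⟨
    u ++ []                 ≈⟨ ++-congˡ u (≈-sym (inverseˡ v [])) ⟩
    u ++ reverse v ++ v ++ []  ≡⟨ cong (λ x → u ++ reverse v ++ x) (++-identityʳ v) ⟩
    u ++ reverse v ++ v     ≡⟨ ++-assoc u (reverse v) v ⟨
    (u ++ reverse v) ++ v   ≈⟨ ++-congʳ v p ⟩
    v                       ∎
    where open ≈-Reasoning

  ≈⇒++-reverse : ∀ {u v} → u ≈ v → u ++ reverse v ≈ []
  ≈⇒++-reverse {u} {v} p = begin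
    u ++ reverse v        ≈⟨ ++-congʳ (reverse v) p ⟩
    v ++ reverse v        ≡⟨ cong (v ++_) (++-identityʳ _) ⟨
    v ++ reverse v ++ []  ≈⟨ inverseʳ v [] ⟩
    []                    ∎
    where open ≈-Reasoning

  reverse-cong : ∀ {u v} → u ≈ v → reverse u ≈ reverse v
  reverse-cong {u} {v} p = ++-cancelˡ u (begin
    u ++ reverse u         ≈⟨ ≈⇒++-reverse {u} ≈-refl ⟩
    []                     ≈⟨ ≈⇒++-reverse p ⟨
    u ++ reverse v         ∎)
    where open ≈-Reasoning

  -- Cancellation drops two letters and a braid move keeps the length; this is the sign character of
  -- the group.
  parity-cong : ∀ {u v} → u ≈ v → parity u ≡ parity v
  parity-cong = EqC.gfold ≡.isEquivalence parity step
    where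
    prefix : ∀ u {v w : Word n} → parity v ≡ parity w → parity (u ++ v) ≡ parity (u ++ w)
    prefix []      p = p
    prefix (x ∷ u) p = cong not (prefix u p)
    alternating : ∀ (s t s' t' : Fin n) k v → parity (alt s t k ++ v) ≡ parity (alt s' t' k ++ v)
    alternating s t s' t' zero    v = refl
    alternating s t s' t' (suc k) v = cong not (alternating t s t' s' k v)
    step : ∀ {u v} → Step M u v → parity u ≡ parity v
    step (cancel u v s)    = prefix u (Bool.not-involutive (parity v))
    step (braid u v s t p) = prefix u (alternating s t t s (m s t) v)

-- Chebyshev polynomials of path adjacency operators

Fun : Set
Fun = ℕ → ℤ

cut : ℕ → ℕ → ℤ → ℤ
cut d i x = if does (d ∣? suc i) then 0ℤ else x

-- The adjacency operator of the graph on ℕ with an edge between i and i + 1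
-- unless d divides i + 1: a union of paths with d vertices (one infinite path if d = 0).
adj : ℕ → Fun → Fun
adj d a zero    = cut d 0 (a 1)
adj d a (suc i) = cut d i (a i) ℤ.+ cut d (suc i) (a (suc (suc i)))

cut-∣ : ∀ {d i} x → d ∣ suc i → cut d i x ≡ 0ℤ
cut-∣ {d} {i} x p = cong (λ b → if b then 0ℤ else x) (dec-true (d ∣? suc i) p)

cut-∤ : ∀ {d i} x → d ∤ suc i → cut d i x ≡ x
cut-∤ {d} {i} x p = cong (λ b → if b then 0ℤ else x) (dec-false (d ∣? suc i) p)

cut-+ : ∀ d i x y → cut d i (x ℤ.+ y) ≡ cut d i x ℤ.+ cut d i y
cut-+ d i x y with does (d ∣? suc i)
... | true  = refl
... | false = refl

cut-neg : ∀ d i x → cut d i (ℤ.- x) ≡ ℤ.- cut d i x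
cut-neg d i x with does (d ∣? suc i)
... | true  = refl
... | false = refl

adj-cong : ∀ d {a b} → a ≗ b → adj d a ≗ adj d b
adj-cong d p zero    = cong (cut d 0) (p 1)
adj-cong d p (suc i) = cong₂ ℤ._+_ (cong (cut d i) (p i)) (cong (cut d (suc i)) (p (suc (suc i))))

adj-+ : ∀ d a b i → adj d (λ j → a j ℤ.+ b j) i ≡ adj d a i ℤ.+ adj d b i
adj-+ d a b zero    = cut-+ d 0 (a 1) (b 1)
adj-+ d a b (suc i) = trans (cong₂ ℤ._+_ (cut-+ d i (a i) (b i)) (cut-+ d (suc i) (a (suc (suc i))) (b (suc (suc i)))))
  (interchange (cut d i (a i)) (cut d i (b i)) (cut d (suc i) (a (suc (suc i)))) (cut d (suc i) (b (suc (suc i)))))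
  where
  interchange : ∀ w x y z → (w ℤ.+ x) ℤ.+ (y ℤ.+ z) ≡ (w ℤ.+ y) ℤ.+ (x ℤ.+ z)
  interchange = ℤ-Solver.solve-∀

adj-neg : ∀ d a i → adj d (λ j → ℤ.- a j) i ≡ ℤ.- adj d a i
adj-neg d a zero    = cut-neg d 0 (a 1)
adj-neg d a (suc i) = trans (cong₂ ℤ._+_ (cut-neg d i _) (cut-neg d (suc i) _)) (sym (ℤ.neg-distrib-+ (cut d i _) _))

adj-0 : ∀ d i → adj d (λ _ → 0ℤ) i ≡ 0ℤ
adj-0 d zero with does (d ∣? 1)
... | true  = refl
... | false = refl
adj-0 d (suc i) with does (d ∣? suc i) | does (d ∣? suc (suc i))
... | true  | true  = refl
... | true  | false = refl
... | false | true  = refl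
... | false | false = refl

adj-minus : ∀ d a b i → adj d (λ j → a j ℤ.- b j) i ≡ adj d a i ℤ.- adj d b i
adj-minus d a b i = trans (adj-+ d a (λ j → ℤ.- b j) i) (cong (λ x → adj d a i ℤ.+ x) (adj-neg d b i))

-- The Chebyshev polynomials of the operator adj d (quantum integers [k] with [2] = adj d).
U : ℕ → ℕ → Fun → Fun
U d zero          a i = 0ℤ
U d (suc zero)    a i = a i
U d (suc (suc k)) a i = adj d (U d (suc k) a) i ℤ.- U d k a i

U-cong : ∀ d k {a b} → a ≗ b → U d k a ≗ U d k b
U-cong d zero          p i = refl
U-cong d (suc zero)    p i = p i
U-cong d (suc (suc k)) p i = cong₂ ℤ._-_ (adj-cong d (U-cong d (suc k) p) i) (U-cong d k p i)

U-minus : ∀ d k a b i → U d k (λ j → a j ℤ.- b j) i ≡ U d k a i ℤ.- U d k b i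
U-minus d zero          a b i = refl
U-minus d (suc zero)    a b i = refl
U-minus d (suc (suc k)) a b i = trans
  (cong₂ ℤ._-_ (trans (adj-cong d (U-minus d (suc k) a b) i) (adj-minus d (U d (suc k) a) (U d (suc k) b) i)) (U-minus d k a b i))
  (interchange (adj d (U d (suc k) a) i) (adj d (U d (suc k) b) i) (U d k a i) (U d k b i))
  where
  interchange : ∀ w x y z → (w ℤ.- x) ℤ.- (y ℤ.- z) ≡ (w ℤ.- y) ℤ.- (x ℤ.- z)
  interchange = ℤ-Solver.solve-∀

U-0 : ∀ d k i → U d k (λ _ → 0ℤ) i ≡ 0ℤ
U-0 d zero          i = refl
U-0 d (suc zero)    i = refl
U-0 d (suc (suc k)) i = cong₂ ℤ._-_ (trans (adj-cong d (U-0 d (suc k)) i) (adj-0 d i)) (U-0 d k i)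

U-adj : ∀ d k a i → U d k (adj d a) i ≡ adj d (U d k a) i
U-adj d zero          a i = sym (adj-0 d i)
U-adj d (suc zero)    a i = refl
U-adj d (suc (suc k)) a i = trans
  (cong₂ ℤ._-_ (adj-cong d (U-adj d (suc k) a) i) (U-adj d k a i))
  (sym (adj-minus d (adj d (U d (suc k) a)) (U d k a) i))

-- All `U d k` are polynomials in the single operator `adj d`. Commuting them lets `U-vanishes` look
-- only at the first vertex of a path.
U-comm : ∀ d j k a i → U d j (U d k a) i ≡ U d k (U d j a) i
U-comm d zero          k a i = sym (U-0 d k i)
U-comm d (suc zero)    k a i = refl
U-comm d (suc (suc j)) k a i = trans
  (cong₂ ℤ._-_ (trans (adj-cong d (U-comm d (suc j) k a) i) (sym (U-adj d k (U d (suc j) a) i))) (U-comm d j k a i))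
  (sym (U-minus d k (adj d (U d (suc j) a)) (U d j a) i))

-- A path of the graph starts at a vertex `p` divisible by `d`, and the condition says that `p + j`
-- still lies on it. For `d = 0` the only start is `0` and the path never ends.
Within : ℕ → ℕ → Set
Within d j = d ≡ 0 ⊎ j < d

within-pred : ∀ {d j} → Within d (suc j) → Within d j
within-pred (inj₁ p) = inj₁ p
within-pred (inj₂ p) = inj₂ (<-trans (n<1+n _) p)

inner : ∀ {d p j} → d ∣ p → Within d (suc j) → d ∤ suc (p + j)
inner {p = p} {j} d∣p (inj₁ refl) q with 0∣⇒≡0 q
... | ()
inner {d} {p} {j} d∣p (inj₂ j<d) q =
  >⇒∤ j<d (∣m+n∣m⇒∣n (subst (d ∣_) (sym (+-suc p j)) q) d∣p)

adj-start : ∀ {d p} a → d ∣ p → adj d a p ≡ cut d p (a (suc p))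
adj-start {p = zero}  a d∣p = refl
adj-start {d} {suc p} a d∣p = trans (cong (ℤ._+ cut d (suc p) (a (suc (suc p)))) (cut-∣ (a p) d∣p)) (ℤ.+-identityˡ _)

-- At the first vertex `p` of a path, the subtracted term of the recursion cancels the backward
-- neighbour, so `U d (suc j)` reads the value `j` vertices further on. `U-step` reads one vertex
-- later, where the path may already have ended.
U-start : ∀ {d p} j a → d ∣ p → Within d j → U d (suc j) a p ≡ a (p + j)
U-step  : ∀ {d p} j a → d ∣ p → Within d j → U d (suc (suc j)) a p ≡ cut d (p + j) (a (suc (p + j)))

U-start {p = p} zero a d∣p j<d = cong a (sym (+-identityʳ p))
U-start {p = p} (suc j) a d∣p j<d = trans (U-step j a d∣p (within-pred j<d))
  (trans (cut-∤ _ (inner d∣p j<d)) (cong a (sym (+-suc p j))))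

U-step {d} {p} j a d∣p j<d = trans
  (cong (ℤ._- U d j a p) (trans (sym (U-adj d (suc j) a p)) (U-start j (adj d a) d∣p j<d)))
  (rest j j<d)
  where
  rest : ∀ j → Within d j → adj d a (p + j) ℤ.- U d j a p ≡ cut d (p + j) (a (suc (p + j)))
  rest zero    j<d rewrite +-identityʳ p = trans (ℤ.+-identityʳ _) (adj-start a d∣p)
  rest (suc j) j<d rewrite +-suc p j = trans
    (cong₂ ℤ._-_ (cong (ℤ._+ next) (cut-∤ (a (p + j)) (inner d∣p j<d))) (U-start j a d∣p (within-pred j<d)))
    (cancel-+ (a (p + j)) next)
    where
    next = cut d (suc (p + j)) (a (suc (suc (p + j))))
    cancel-+ : ∀ x y → (x ℤ.+ y) ℤ.- x ≡ y
    cancel-+ = ℤ-Solver.solve-∀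

-- The value at `p + r` is that of `U d (suc r)` at the start `p` of the path. After commuting,
-- `U d (suc d)` at `p` reads one vertex beyond the end, which gives zero. This replaces the
-- vanishing of `sin (m θ)` at `θ = π / m`, where `m = d + 1`.
U-vanishes : ∀ e a i → U (suc e) (suc (suc e)) a i ≡ 0ℤ
U-vanishes e a i = begin
  U d (suc d) a i                     ≡⟨ cong (U d (suc d) a) (trans (m≡m%n+[m/n]*n i d) (+-comm r p)) ⟩
  U d (suc d) a (p + r)               ≡⟨ U-start r (U d (suc d) a) d∣p (inj₂ (m%n<n i d)) ⟨
  U d (suc r) (U d (suc d) a) p       ≡⟨ U-comm d (suc r) (suc d) a p ⟩
  U d (suc d) (U d (suc r) a) p       ≡⟨ U-step e _ d∣p (inj₂ (n<1+n e)) ⟩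
  cut d (p + e) _                     ≡⟨ cut-∣ _ (subst (d ∣_) (+-suc p e) (∣m∣n⇒∣m+n d∣p ∣-refl)) ⟩
  0ℤ                                  ∎
  where
  open ≡-Reasoning
  d = suc e
  r = i % d
  p = (i / d) * d
  d∣p : d ∣ p
  d∣p = n∣m*n (i / d)

U-pred-vanishes : ∀ {k} → k ≢ 0 → k ≢ 1 → ∀ a i → U (k ∸ 1) k a i ≡ 0ℤ
U-pred-vanishes {zero}        p q = contradiction refl p
U-pred-vanishes {suc zero}    p q = contradiction refl q
U-pred-vanishes {suc (suc e)} p q = U-vanishes e

within-∸1 : ∀ {k e} → k ≡ 0 ⊎ suc e < k → Within (k ∸ 1) e
within-∸1         (inj₁ refl)      = inj₁ refl
within-∸1 {suc k} (inj₂ (s<s e<k)) = inj₂ e<k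

-- The order of s t

module NumbersGame {n} (M : CoxeterMatrix n) where
  open Words M
  open CoxeterMatrix M using (symm; offdiag)

  Config : Set
  Config = Fin n → Fun

  infix 4 _≐_
  _≐_ : Config → Config → Set
  f ≐ g = ∀ r i → f r i ≡ g r i

  -- The contribution of a firing of `s` to `r`, with factor `-2` on the diagonal and the path
  -- operator for `2 cos (π / m)` elsewhere. Truncated subtraction sends the code `0` of infinity to
  -- the infinite path; `m = 2` gives isolated vertices, hence the zero operator.
  push : Fin n → Fin n → Fun → Fun
  push s r a i = if does (s ≟ r) then ℤ.- (a i ℤ.+ a i) else adj (m s r ∸ 1) a i

  fire : Fin n → Config → Config
  fire s f r i = f r i ℤ.+ push s r (f s) i

  act : Word n → Config → Config
  act []      f = f
  act (s ∷ w) f = act w (fire s f)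

  push-self : ∀ s a i → push s s a i ≡ ℤ.- (a i ℤ.+ a i)
  push-self s a i = cong (λ b → if b then ℤ.- (a i ℤ.+ a i) else adj (m s s ∸ 1) a i) (dec-true (s ≟ s) refl)

  push-other : ∀ {s r} → s ≢ r → ∀ a i → push s r a i ≡ adj (m s r ∸ 1) a i
  push-other {s} {r} p a i = cong (λ b → if b then ℤ.- (a i ℤ.+ a i) else adj (m s r ∸ 1) a i) (dec-false (s ≟ r) p)

  push-cong : ∀ s r {a b} → a ≗ b → push s r a ≗ push s r b
  push-cong s r p i with does (s ≟ r)
  ... | true  = cong (λ x → ℤ.- (x ℤ.+ x)) (p i)
  ... | false = adj-cong (m s r ∸ 1) p i

  push-+ : ∀ s r a b i → push s r (λ j → a j ℤ.+ b j) i ≡ push s r a i ℤ.+ push s r b i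
  push-+ s r a b i with does (s ≟ r)
  ... | true  = double-+ (a i) (b i)
    where
    double-+ : ∀ x y → ℤ.- ((x ℤ.+ y) ℤ.+ (x ℤ.+ y)) ≡ ℤ.- (x ℤ.+ x) ℤ.+ ℤ.- (y ℤ.+ y)
    double-+ = ℤ-Solver.solve-∀
  ... | false = adj-+ (m s r ∸ 1) a b i

  push-neg : ∀ s r a i → push s r (λ j → ℤ.- a j) i ≡ ℤ.- push s r a i
  push-neg s r a i with does (s ≟ r)
  ... | true  = double-neg (a i)
    where
    double-neg : ∀ x → ℤ.- (ℤ.- x ℤ.+ ℤ.- x) ≡ ℤ.- (ℤ.- (x ℤ.+ x))
    double-neg = ℤ-Solver.solve-∀
  ... | false = adj-neg (m s r ∸ 1) a i

  push-0 : ∀ s r i → push s r (λ _ → 0ℤ) i ≡ 0ℤ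
  push-0 s r i with does (s ≟ r)
  ... | true  = refl
  ... | false = adj-0 (m s r ∸ 1) i

  fire-cong : ∀ s {f g} → f ≐ g → fire s f ≐ fire s g
  fire-cong s p r i = cong₂ ℤ._+_ (p r i) (push-cong s r (p s) i)

  act-cong : ∀ w {f g} → f ≐ g → act w f ≐ act w g
  act-cong []      p = p
  act-cong (s ∷ w) p = act-cong w (fire-cong s p)

  act-++ : ∀ u v f → act (u ++ v) f ≡ act v (act u f)
  act-++ []      v f = refl
  act-++ (s ∷ u) v f = act-++ u v (fire s f)

  act-alt-suc : ∀ s t k f → act (alt s t (suc k)) f ≡ fire (letter s t k) (act (alt s t k) f)
  act-alt-suc s t zero    f = refl
  act-alt-suc s t (suc k) f = act-alt-suc t s k (fire s f)

  fire-self : ∀ s f i → fire s f s i ≡ ℤ.- f s i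
  fire-self s f i = trans (cong (λ x → f s i ℤ.+ x) (push-self s (f s) i)) (reflect (f s i))
    where
    reflect : ∀ x → x ℤ.+ ℤ.- (x ℤ.+ x) ≡ ℤ.- x
    reflect = ℤ-Solver.solve-∀

  fire-fire : ∀ s f → fire s (fire s f) ≐ f
  fire-fire s f r i = trans
    (cong (λ x → fire s f r i ℤ.+ x) (trans (push-cong s r (fire-self s f) i) (push-neg s r (f s) i)))
    (cancel-+ (f r i) (push s r (f s) i))
    where
    cancel-+ : ∀ x y → (x ℤ.+ y) ℤ.+ ℤ.- y ≡ x
    cancel-+ = ℤ-Solver.solve-∀

  module Alternating (s t : Fin n) (s≢t : s ≢ t) where
    d : ℕ
    d = m s t ∸ 1

    push-letter : ∀ k a i → push (letter s t k) (letter t s k) a i ≡ adj d a i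
    push-letter k a i = proj₁ (both k)
      where
      both : ∀ k → push (letter s t k) (letter t s k) a i ≡ adj d a i
                 × push (letter t s k) (letter s t k) a i ≡ adj d a i
      both zero    = push-other s≢t a i ,
                     trans (push-other (≢-sym s≢t) a i) (cong (λ x → adj (x ∸ 1) a i) (symm t s))
      both (suc k) = proj₂ (both k) , proj₁ (both k)

    -- U⁻ k is U (k ∸ 1), with U (-1) = - U 1.
    U⁻ : ℕ → Fun → Fun
    U⁻ zero    a i = ℤ.- a i
    U⁻ (suc k) a i = U d k a i

    U-suc : ∀ k a i → U d (suc k) a i ≡ adj d (U d k a) i ℤ.- U⁻ k a i
    U-suc zero    a i = trans (neg-neg (a i)) (cong (λ x → x ℤ.- (ℤ.- a i)) (sym (adj-0 d i)))
      where
      neg-neg : ∀ x → x ≡ 0ℤ ℤ.- (ℤ.- x)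
      neg-neg = ℤ-Solver.solve-∀
    U-suc (suc k) a i = refl

    -- Value fired at step k (from 0) of s t s … when s, t start with a, b.
    fired : ℕ → Fun → Fun → Fun
    fired k a b i = U d (suc k) a i ℤ.+ U d k b i

    -- Total values fired during k steps at the letter of step k ∸ 1, resp. of step k.
    last next : ℕ → Fun → Fun → Fun
    last zero    a b i = 0ℤ
    last (suc k) a b i = next k a b i ℤ.+ fired k a b i
    next zero    a b i = 0ℤ
    next (suc k) a b i = last k a b i

    -- For the two alternating words of length `k` run from the same configuration, `last k a b` and
    -- `next k b a` are totals at the same letter. Their difference `U d k a` vanishes for
    -- `k = m s t`, which yields the braid relation.
    last-next : ∀ k a b i → last k a b i ≡ next k b a i ℤ.+ U d k a i
    last-next zero    a b i = refl
    last-next (suc k) a b i = trans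
      (exchange (next k a b i) (U d (suc k) a i) (U d k b i))
      (cong (ℤ._+ U d (suc k) a i) (sym (last-next k b a i)))
      where
      exchange : ∀ x y z → x ℤ.+ (y ℤ.+ z) ≡ (x ℤ.+ z) ℤ.+ y
      exchange = ℤ-Solver.solve-∀

    -- The state after `k` alternate firings: `p` is due next, `q` was fired last, if any was, and
    -- `a`, `b` are the initial values at the letter fired first and at the other one. For `k = 0`
    -- the convention in `U⁻` makes `at-last` the initial value `b`.
    record Trace (p q : Fin n) (k : ℕ) (f : Config) (a b : Fun) (g : Config) : Set where
      field
        at-next : ∀ i → g p i ≡ fired k a b i
        at-last : ∀ i → g q i ≡ ℤ.- (U d k a i ℤ.+ U⁻ k b i)
        at-all  : ∀ r i → g r i ≡ f r i ℤ.+ (push q r (last k a b) i ℤ.+ push p r (next k a b) i)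

    open Trace public

    trace-fire : ∀ {p q k f a b g} → (∀ a i → push p q a i ≡ adj d a i) →
                 Trace p q k f a b g → Trace q p (suc k) f a b (fire p g)
    trace-fire {p} {q} {k} {f} {a} {b} {g} push-pq T = record
      { at-next = λ i → begin
          g q i ℤ.+ push p q (g p) i
            ≡⟨ cong₂ ℤ._+_ (at-last T i) (trans (push-pq (g p) i) (adj-cong d (at-next T) i)) ⟩
          ℤ.- (U d k a i ℤ.+ U⁻ k b i) ℤ.+ adj d (fired k a b) i
            ≡⟨ cong (λ x → ℤ.- (U d k a i ℤ.+ U⁻ k b i) ℤ.+ x) (adj-+ d (U d (suc k) a) (U d k b) i) ⟩
          ℤ.- (U d k a i ℤ.+ U⁻ k b i) ℤ.+ (adj d (U d (suc k) a) i ℤ.+ adj d (U d k b) i)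
            ≡⟨ rearrange (U d k a i) (U⁻ k b i) (adj d (U d (suc k) a) i) (adj d (U d k b) i) ⟩
          U d (suc (suc k)) a i ℤ.+ (adj d (U d k b) i ℤ.- U⁻ k b i)
            ≡⟨ cong (λ x → U d (suc (suc k)) a i ℤ.+ x) (U-suc k b i) ⟨
          fired (suc k) a b i ∎
      ; at-last = λ i → trans (fire-self p g i) (cong ℤ.-_ (at-next T i))
      ; at-all = λ r i → begin
          g r i ℤ.+ push p r (g p) i
            ≡⟨ cong₂ ℤ._+_ (at-all T r i) (push-cong p r (at-next T) i) ⟩
          (f r i ℤ.+ (push q r (last k a b) i ℤ.+ push p r (next k a b) i)) ℤ.+ push p r (fired k a b) i
            ≡⟨ shuffle (f r i) (push q r (last k a b) i) (push p r (next k a b) i) (push p r (fired k a b) i) ⟩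
          f r i ℤ.+ ((push p r (next k a b) i ℤ.+ push p r (fired k a b) i) ℤ.+ push q r (last k a b) i)
            ≡⟨ cong (λ x → f r i ℤ.+ (x ℤ.+ push q r (last k a b) i)) (push-+ p r (next k a b) (fired k a b) i) ⟨
          f r i ℤ.+ (push p r (last (suc k) a b) i ℤ.+ push q r (next (suc k) a b) i) ∎
      }
      where
      open ≡-Reasoning
      rearrange : ∀ w x y z → ℤ.- (w ℤ.+ x) ℤ.+ (y ℤ.+ z) ≡ (y ℤ.- w) ℤ.+ (z ℤ.- x)
      rearrange = ℤ-Solver.solve-∀
      shuffle : ∀ w x y z → (w ℤ.+ (x ℤ.+ y)) ℤ.+ z ≡ w ℤ.+ ((y ℤ.+ z) ℤ.+ x)
      shuffle = ℤ-Solver.solve-∀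

    trace-start : ∀ p q f → Trace p q 0 f (f p) (f q) f
    trace-start p q f = record
      { at-next = λ i → sym (ℤ.+-identityʳ _)
      ; at-last = λ i → neg-neg (f q i)
      ; at-all  = λ r i → sym (trans (cong (λ x → f r i ℤ.+ x) (cong₂ ℤ._+_ (push-0 q r i) (push-0 p r i))) (ℤ.+-identityʳ _))
      }
      where
      neg-neg : ∀ x → x ≡ ℤ.- (0ℤ ℤ.+ ℤ.- x)
      neg-neg = ℤ-Solver.solve-∀

    trace-s : ∀ k f → Trace (letter s t k) (letter t s k) k f (f s) (f t) (act (alt s t k) f)
    trace-s zero    f = trace-start s t f
    trace-s (suc k) f = subst (Trace _ _ _ f (f s) (f t)) (sym (act-alt-suc s t k f))
      (trace-fire (push-letter k) (trace-s k f))

    trace-t : ∀ k f → Trace (letter t s k) (letter s t k) k f (f t) (f s) (act (alt t s k) f)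
    trace-t zero    f = trace-start t s f
    trace-t (suc k) f = subst (Trace _ _ _ f (f t) (f s)) (sym (act-alt-suc t s k f))
      (trace-fire (push-letter (suc k)) (trace-t k f))

    act-braid : m s t ≢ 0 → ∀ f → act (alt s t (m s t)) f ≐ act (alt t s (m s t)) f
    act-braid m≢0 f r i = begin
      act (alt s t k) f r i
        ≡⟨ at-all (trace-s k f) r i ⟩
      f r i ℤ.+ (push (letter t s k) r (last k a b) i ℤ.+ push (letter s t k) r (next k a b) i)
        ≡⟨ cong (λ x → f r i ℤ.+ x) (ℤ.+-comm (push (letter t s k) r (last k a b) i) _) ⟩
      f r i ℤ.+ (push (letter s t k) r (next k a b) i ℤ.+ push (letter t s k) r (last k a b) i)
        ≡⟨ cong (λ x → f r i ℤ.+ x) (cong₂ ℤ._+_ (push-cong (letter s t k) r (last≗next b a) i)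
                                                (push-cong (letter t s k) r (λ j → sym (last≗next a b j)) i)) ⟨
      f r i ℤ.+ (push (letter s t k) r (last k b a) i ℤ.+ push (letter t s k) r (next k b a) i)
        ≡⟨ at-all (trace-t k f) r i ⟨
      act (alt t s k) f r i ∎
      where
      open ≡-Reasoning
      k = m s t
      a = f s
      b = f t
      vanish : ∀ a j → U d k a j ≡ 0ℤ
      vanish a j = U-pred-vanishes m≢0 (offdiag s t s≢t) a j
      last≗next : ∀ a b j → last k a b j ≡ next k b a j
      last≗next a b j = trans (last-next k a b j) (trans (cong (λ x → next k b a j ℤ.+ x) (vanish a j)) (ℤ.+-identityʳ _))

  act-step : ∀ {u v} → Step M u v → ∀ f → act u f ≐ act v f
  act-step (cancel u v s) f rewrite act-++ u (s ∷ s ∷ v) f | act-++ u v f =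
    act-cong v (fire-fire s (act u f))
  act-step (braid u v s t m≢0) f
    rewrite act-++ u (alt s t (m s t) ++ v) f | act-++ u (alt t s (m s t) ++ v) f
          | act-++ (alt s t (m s t)) v (act u f) | act-++ (alt t s (m s t)) v (act u f) =
    act-cong v (same (s ≟ t))
    where
    same : Dec (s ≡ t) → act (alt s t (m s t)) (act u f) ≐ act (alt t s (m s t)) (act u f)
    same (yes refl) r i = refl
    same (no s≢t)   r i = Alternating.act-braid s t s≢t m≢0 (act u f) r i

  act-≈ : ∀ {u v} → u ≈ v → ∀ f → act u f ≐ act v f
  act-≈ = EqC.fold equiv act-step
    where
    equiv : IsEquivalence (λ u v → ∀ f → act u f ≐ act v f)
    equiv = record
      { refl  = λ f r i → refl
      ; sym   = λ p f r i → sym (p f r i)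
      ; trans = λ p q f r i → trans (p f r i) (q f r i)
      }

  -- Started from the value 1 at t and 0 elsewhere, the two words leave opposite
  -- values [e] 1 and - [e] 1 at the letter that s t s … would fire next.
  alt-≉ : ∀ {s t} → s ≢ t → ∀ e → m s t ≡ 0 ⊎ suc e < m s t → ¬ alt s t (suc e) ≈ alt t s (suc e)
  alt-≉ {s} {t} s≢t e order p = absurd (trans (sym (at-next (trace-s k f) 0))
                                        (trans (act-≈ p f (letter s t k) 0) (at-last (trace-t k f) 0)))
    where
    open Alternating s t s≢t
    k = suc e
    f : Config
    f r i = if does (r ≟ t) then 1ℤ else 0ℤ
    f-s : ∀ i → f s i ≡ 0ℤ
    f-s i = cong (λ b → if b then 1ℤ else 0ℤ) (dec-false (s ≟ t) s≢t)
    f-t : ∀ i → f t i ≡ 1ℤ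
    f-t i = cong (λ b → if b then 1ℤ else 0ℤ) (dec-true (t ≟ t) refl)
    within : Within d e
    within = within-∸1 order
    U-f-s : ∀ j → U d j (f s) 0 ≡ 0ℤ
    U-f-s j = trans (U-cong d j f-s 0) (U-0 d j 0)
    -- Vertex `0` begins a path and `e` lies on it, so this reads the constant function 1 at `e`.
    U-f-t : U d k (f t) 0 ≡ 1ℤ
    U-f-t = trans (U-start e (f t) (d ∣0) within) (f-t e)
    absurd : ¬ fired k (f s) (f t) 0 ≡ ℤ.- (U d k (f t) 0 ℤ.+ U⁻ k (f s) 0)
    absurd q with trans (sym (cong₂ ℤ._+_ (U-f-s (suc k)) U-f-t)) (trans q (cong₂ (λ x y → ℤ.- (x ℤ.+ y)) U-f-t (U-f-s e)))
    ... | ()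

-- Counting reflections

data Deletes {A : Set} : List A → List A → Set where
  here  : ∀ {x xs} → Deletes xs (x ∷ xs)
  there : ∀ {x xs ys} → Deletes xs ys → Deletes (x ∷ xs) (x ∷ ys)

module _ {A : Set} where
  Deletes⇒⊆ : {xs ys : List A} → Deletes xs ys → xs ⊆ ys
  Deletes⇒⊆ (here {x})  = x ∷ʳ ⊆-refl
  Deletes⇒⊆ (there d) = refl ∷ Deletes⇒⊆ d

  length-Deletes : {xs ys : List A} → Deletes xs ys → length ys ≡ suc (length xs)
  length-Deletes here      = refl
  length-Deletes (there d) = cong suc (length-Deletes d)

  Deletes-++ : ∀ (ys : List A) {zs xs} → Deletes xs (ys ++ zs) →
               (∃ λ ys' → Deletes ys' ys × xs ≡ ys' ++ zs) ⊎ (∃ λ zs' → Deletes zs' zs × xs ≡ ys ++ zs')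
  Deletes-++ []       d         = inj₂ (_ , d , refl)
  Deletes-++ (y ∷ ys) here      = inj₁ (ys , here , refl)
  Deletes-++ (y ∷ ys) (there d) with Deletes-++ ys d
  ... | inj₁ (ys' , d' , refl) = inj₁ (y ∷ ys' , there d' , refl)
  ... | inj₂ (zs' , d' , refl) = inj₂ (zs' , d' , refl)

module Reflections {n} (M : CoxeterMatrix n) where
  open Words M

  conj : Fin n → Word n → Word n
  conj s r = s ∷ r ++ [ s ]

  conjs : Word n → Word n → Word n
  conjs []      r = r
  conjs (s ∷ u) r = conj s (conjs u r)

  -- The reflections s₁ ⋯ sᵢ₋₁ sᵢ sᵢ₋₁ ⋯ s₁ of a word s₁ ⋯ sₖ.
  N : Word n → List (Word n)
  N []      = []
  N (s ∷ w) = [ s ] ∷ map (conj s) (N w)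

  conj-cong : ∀ s {u v} → u ≈ v → conj s u ≈ conj s v
  conj-cong s p = ∷-cong s (++-congʳ [ s ] p)

  conj-conj : ∀ s r → conj s (conj s r) ≈ r
  conj-conj s r = begin
    s ∷ s ∷ (r ++ [ s ]) ++ [ s ]  ≈⟨ ∷-∷-cancel s _ ⟩
    (r ++ [ s ]) ++ [ s ]          ≡⟨ ++-assoc r [ s ] [ s ] ⟩
    r ++ s ∷ s ∷ []        ≈⟨ ++-congˡ r (∷-∷-cancel s []) ⟩
    r ++ []                ≡⟨ ++-identityʳ r ⟩
    r                      ∎
    where open ≈-Reasoning

  conj-adjoint : ∀ s {u v} → conj s u ≈ v → u ≈ conj s v
  conj-adjoint s {u} p = ≈-trans (≈-sym (conj-conj s u)) (conj-cong s p)

  conj-generator : ∀ s → conj s [ s ] ≈ [ s ]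
  conj-generator s = ∷-∷-cancel s [ s ]

  conjs-reverse : ∀ u r → conjs u r ≡ u ++ r ++ reverse u
  conjs-reverse []      r = sym (++-identityʳ r)
  conjs-reverse (s ∷ u) r = cong (s ∷_) (begin
    conjs u r ++ [ s ]             ≡⟨ cong (_++ [ s ]) (conjs-reverse u r) ⟩
    (u ++ r ++ reverse u) ++ [ s ] ≡⟨ ++-assoc u _ [ s ] ⟩
    u ++ (r ++ reverse u) ++ [ s ] ≡⟨ cong (u ++_) (++-assoc r (reverse u) [ s ]) ⟩
    u ++ r ++ reverse u ++ [ s ]   ≡⟨ cong (λ x → u ++ r ++ x) (reverse-++ [ s ] u) ⟨
    u ++ r ++ reverse (s ∷ u)      ∎)
    where open ≡-Reasoning

  conjs-congˡ : ∀ {u v} r → u ≈ v → conjs u r ≈ conjs v r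
  conjs-congˡ {u} {v} r p = begin
    conjs u r            ≡⟨ conjs-reverse u r ⟩
    u ++ r ++ reverse u  ≈⟨ ++-cong p (++-congˡ r (reverse-cong p)) ⟩
    v ++ r ++ reverse v  ≡⟨ conjs-reverse v r ⟨
    conjs v r            ∎
    where open ≈-Reasoning

  -- Equality of multisets of elements modulo 2.
  infix 4 _~_
  data _~_ : List (Word n) → List (Word n) → Set where
    ~refl  : ∀ {K} → K ~ K
    ~sym   : ∀ {K L} → K ~ L → L ~ K
    ~trans : ∀ {K L P} → K ~ L → L ~ P → K ~ P
    ~cons  : ∀ {x y K L} → x ≈ y → K ~ L → x ∷ K ~ y ∷ L
    ~swap  : ∀ x y K → x ∷ y ∷ K ~ y ∷ x ∷ K
    ~pair  : ∀ {x y} K → x ≈ y → x ∷ y ∷ K ~ K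

  ~-reflexive : ∀ {K L} → K ≡ L → K ~ L
  ~-reflexive refl = ~refl

  ~-isEquivalence : IsEquivalence _~_
  ~-isEquivalence = record { refl = ~refl ; sym = ~sym ; trans = ~trans }

  ~-++ˡ : ∀ P {K L} → K ~ L → P ++ K ~ P ++ L
  ~-++ˡ []      p = p
  ~-++ˡ (x ∷ P) p = ~cons ≈-refl (~-++ˡ P p)

  ~-++ʳ : ∀ P {K L} → K ~ L → K ++ P ~ L ++ P
  ~-++ʳ P ~refl        = ~refl
  ~-++ʳ P (~sym p)     = ~sym (~-++ʳ P p)
  ~-++ʳ P (~trans p q) = ~trans (~-++ʳ P p) (~-++ʳ P q)
  ~-++ʳ P (~cons e p)  = ~cons e (~-++ʳ P p)
  ~-++ʳ P (~swap x y K) = ~swap x y (K ++ P)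
  ~-++ʳ P (~pair K e)  = ~pair (K ++ P) e

  ~-shift : ∀ P x K → P ++ x ∷ K ~ x ∷ P ++ K
  ~-shift []      x K = ~refl
  ~-shift (y ∷ P) x K = ~trans (~cons ≈-refl (~-shift P x K)) (~swap y x (P ++ K))

  ~-map-conj : ∀ s {K L} → K ~ L → map (conj s) K ~ map (conj s) L
  ~-map-conj s ~refl        = ~refl
  ~-map-conj s (~sym p)     = ~sym (~-map-conj s p)
  ~-map-conj s (~trans p q) = ~trans (~-map-conj s p) (~-map-conj s q)
  ~-map-conj s (~cons e p)  = ~cons (conj-cong s e) (~-map-conj s p)
  ~-map-conj s (~swap x y K) = ~swap _ _ _
  ~-map-conj s (~pair K e)  = ~pair _ (conj-cong s e)

  map-conj-conjs : ∀ s u K → map (conj s) (map (conjs u) K) ≡ map (conjs (s ∷ u)) K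
  map-conj-conjs s u K = sym (map-∘ K)

  ~-map-conjs : ∀ u {K L} → K ~ L → map (conjs u) K ~ map (conjs u) L
  ~-map-conjs [] {K} {L} p = subst₂ _~_ (sym (map-id K)) (sym (map-id L)) p
  ~-map-conjs (s ∷ u) {K} {L} p = subst₂ _~_ (map-conj-conjs s u K) (map-conj-conjs s u L)
    (~-map-conj s (~-map-conjs u p))

  map-conjs-cong : ∀ {u v} K → u ≈ v → map (conjs u) K ~ map (conjs v) K
  map-conjs-cong []      p = ~refl
  map-conjs-cong (x ∷ K) p = ~cons (conjs-congˡ x p) (map-conjs-cong K p)

  N-++ : ∀ u v → N (u ++ v) ≡ N u ++ map (conjs u) (N v)
  N-++ []      v = sym (map-id (N v))
  N-++ (s ∷ u) v = cong ([ s ] ∷_) (begin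
    map (conj s) (N (u ++ v))                                 ≡⟨ cong (map (conj s)) (N-++ u v) ⟩
    map (conj s) (N u ++ map (conjs u) (N v))                 ≡⟨ map-++ (conj s) (N u) _ ⟩
    map (conj s) (N u) ++ map (conj s) (map (conjs u) (N v))  ≡⟨ cong (map (conj s) (N u) ++_) (map-conj-conjs s u (N v)) ⟩
    map (conj s) (N u) ++ map (conjs (s ∷ u)) (N v)           ∎)
    where open ≡-Reasoning

  -- Identifies the reflections of an alternating word: the letter at position `k` contributes the
  -- alternating word with `2 k + 1` letters.
  conjs-alt : ∀ s t k → conjs (alt s t k) [ letter s t k ] ≡ alt s t (suc (k + k))
  conjs-alt s t zero    = refl
  conjs-alt s t (suc k) = trans (cong (conj s) (conjs-alt t s k)) (alt-conj s t k)

  N-alt : ∀ s t k → N (alt s t (suc k)) ≡ N (alt s t k) ++ [ alt s t (suc (k + k)) ]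
  N-alt s t k = begin
    N (alt s t (suc k))                                        ≡⟨ cong N (alt-∷ʳ s t k) ⟩
    N (alt s t k ++ [ letter s t k ])                          ≡⟨ N-++ (alt s t k) _ ⟩
    N (alt s t k) ++ [ conjs (alt s t k) [ letter s t k ] ]    ≡⟨ cong (λ x → N (alt s t k) ++ [ x ]) (conjs-alt s t k) ⟩
    N (alt s t k) ++ [ alt s t (suc (k + k)) ]                 ∎
    where open ≡-Reasoning

  -- Odd alternating words are palindromes, hence their own inverses. The quotient of the two sides
  -- is therefore `(s t)^(j + k + 1)`, trivial by the hypothesis.
  alt-complement : ∀ s t j k → alt s t (suc (j + k)) ≈ alt t s (suc (j + k)) →
                   alt s t (suc (j + j)) ≈ alt t s (suc (k + k))
  alt-complement s t j k p = ++-reverse⇒≈ _ _ (begin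
    alt s t (suc (j + j)) ++ reverse (alt t s (suc (k + k)))
      ≡⟨ cong (alt s t (suc (j + j)) ++_) (reverse-alt-odd t s k) ⟩
    alt s t (suc (j + j)) ++ alt t s (suc (k + k))
      ≡⟨ cong₂ (λ p q → alt s t (suc (j + j)) ++ alt p q (suc (k + k))) (letter-odd s t j) (letter-odd t s j) ⟨
    alt s t (suc (j + j)) ++ alt (letter s t (suc (j + j))) (letter t s (suc (j + j))) (suc (k + k))
      ≡⟨ alt-+ s t (suc (j + j)) (suc (k + k)) ⟨
    alt s t (suc (j + j) + suc (k + k))
      ≡⟨ cong (alt s t) (sum j k) ⟩
    alt s t (suc (j + k) + suc (j + k))
      ≡⟨ alt-double s t (suc (j + k)) ⟩
    alt s t (suc (j + k)) ++ reverse (alt t s (suc (j + k)))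
      ≈⟨ ≈⇒++-reverse p ⟩
    [] ∎)
    where
    open ≈-Reasoning
    sum : ∀ j k → suc (j + j) + suc (k + k) ≡ suc (j + k) + suc (j + k)
    sum = ℕ-Solver.solve-∀

  N-alt-braid : ∀ s t k → alt s t k ≈ alt t s k → N (alt s t k) ~ N (alt t s k)
  N-alt-braid s t k p = ~sym (~trans (exchange k 0 (+-identityʳ k)) (~-reflexive (++-identityʳ _)))
    where
    -- Each round trades the last remaining reflection of `t s …` for the next one of `s t …`; the
    -- two agree by `alt-complement`.
    exchange : ∀ j i → j + i ≡ k → N (alt t s k) ~ N (alt s t j) ++ N (alt t s i)
    exchange zero    i refl = ~refl
    exchange (suc j) i refl =
      ~trans (exchange j (suc i) (+-suc j i))
      (~trans (~-reflexive (trans (cong (N (alt s t j) ++_) (N-alt t s i)) (sym (++-assoc (N (alt s t j)) _ _))))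
      (~trans (~-shift (N (alt s t j) ++ N (alt t s i)) _ [])
      (~trans (~cons (≈-sym (alt-complement s t j i p)) (~-reflexive (++-identityʳ _)))
      (~trans (~sym (~-shift (N (alt s t j)) _ (N (alt t s i))))
      (~-reflexive (trans (sym (++-assoc (N (alt s t j)) _ _)) (cong (_++ N (alt t s i)) (sym (N-alt s t j)))))))))

  N-≈ : ∀ {u v} → u ≈ v → N u ~ N v
  N-≈ = EqC.gfold ~-isEquivalence N step
    where
    prefix : ∀ u {v w} → N v ~ N w → N (u ++ v) ~ N (u ++ w)
    prefix u {v} {w} p = subst₂ _~_ (sym (N-++ u v)) (sym (N-++ u w)) (~-++ˡ (N u) (~-map-conjs u p))
    map-conj-conj : ∀ s K → map (conj s) (map (conj s) K) ~ K
    map-conj-conj s []      = ~refl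
    map-conj-conj s (x ∷ K) = ~cons (conj-conj s x) (map-conj-conj s K)
    step : ∀ {u v} → Step M u v → N u ~ N v
    -- The reflection `s` occurs twice and disappears modulo 2; the reflections of `v` are
    -- conjugated by `s` twice.
    step (cancel u v s) = prefix u (~trans (~pair _ (≈-sym (conj-generator s))) (map-conj-conj s (N v)))
    step (braid u v s t m≢0) = prefix u (subst₂ _~_ (sym (N-++ (alt s t k) v)) (sym (N-++ (alt t s k) v))
      (~trans (~-++ʳ _ (N-alt-braid s t k (alt-braid s t m≢0)))
              (~-++ˡ (N (alt t s k)) (map-conjs-cong (N v) (alt-braid s t m≢0)))))
      where k = m s t

  -- Count t L b: the number of members of L equal to t is odd iff b.  Equality of
  -- elements is not known to be decidable yet, so this is a relation, total up to ¬¬.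
  data Count (t : Word n) : List (Word n) → Bool → Set where
    []   : Count t [] false
    hit  : ∀ {x L b} → x ≈ t → Count t L b → Count t (x ∷ L) (not b)
    miss : ∀ {x L b} → ¬ x ≈ t → Count t L b → Count t (x ∷ L) b

  count-total : ∀ t L → ¬ ¬ (∃ λ b → Count t L b)
  count-total t []      k = k (false , [])
  count-total t (x ∷ L) k = count-total t L λ (b , c) → ¬¬-excluded-middle λ where
    (yes p) → k (not b , hit p c)
    (no ¬p) → k (b , miss ¬p c)

  count-unique : ∀ {t L b b'} → Count t L b → Count t L b' → b ≡ b'

  count-unique []         []          = refl
  count-unique (hit p c)  (hit q c')  = cong not (count-unique c c')
  count-unique (hit p c)  (miss q c') = contradiction p q
  count-unique (miss p c) (hit q c')  = contradiction q p
  count-unique (miss p c) (miss q c') = count-unique c c'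

  count-~ : ∀ {t K L b b'} → K ~ L → Count t K b → Count t L b' → b ≡ b'
  count-~ ~refl c c' = count-unique c c'
  count-~ (~sym p) c c' = sym (count-~ p c' c)
  -- The middle list has a count only up to double negation; this suffices because equality of
  -- Booleans is decidable.
  count-~ {t} {b = b} {b'} (~trans {L = L} p q) c c' = decidable-stable (b Bool.≟ b') λ k →
    count-total t L λ (_ , c'') → k (trans (count-~ p c c'') (count-~ q c'' c'))
  count-~ (~cons e p) (hit x c)  (hit y c')  = cong not (count-~ p c c')
  count-~ (~cons e p) (hit x c)  (miss y c') = contradiction (≈-trans (≈-sym e) x) y
  count-~ (~cons e p) (miss x c) (hit y c')  = contradiction (≈-trans e y) x
  count-~ (~cons e p) (miss x c) (miss y c') = count-~ p c c'
  count-~ (~swap x y K) (hit p (hit q c)) c'   = count-unique (hit q (hit p c)) c'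
  count-~ (~swap x y K) (hit p (miss q c)) c'  = count-unique (miss q (hit p c)) c'
  count-~ (~swap x y K) (miss p (hit q c)) c'  = count-unique (hit q (miss p c)) c'
  count-~ (~swap x y K) (miss p (miss q c)) c' = count-unique (miss q (miss p c)) c'
  count-~ (~pair K e) (hit p (hit q c)) c'   = trans (Bool.not-involutive _) (count-unique c c')
  count-~ (~pair K e) (hit p (miss q c)) c'  = contradiction (≈-trans (≈-sym e) p) q
  count-~ (~pair K e) (miss p (hit q c)) c'  = contradiction (≈-trans e q) p
  count-~ (~pair K e) (miss p (miss q c)) c' = count-unique c c'

  count-map-conj : ∀ s {t L b} → Count (conj s t) L b → Count t (map (conj s) L) b
  count-map-conj s []         = []
  count-map-conj s {t} (hit p c)  = hit (≈-sym (conj-adjoint s (≈-sym p))) (count-map-conj s c)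
  count-map-conj s (miss p c) = miss (p ∘ conj-adjoint s) (count-map-conj s c)

  count-cong : ∀ {t t' L b} → t ≈ t' → Count t L b → Count t' L b
  count-cong e []         = []
  count-cong e (hit p c)  = hit (≈-trans p e) (count-cong e c)
  count-cong e (miss p c) = miss (λ q → p (≈-trans q (≈-sym e))) (count-cong e c)

  count-true⇒Any : ∀ {t L} → Count t L true → Any (_≈ t) L
  count-true⇒Any c = go c refl
    where
    go : ∀ {t L b} → Count t L b → b ≡ true → Any (_≈ t) L
    go (hit p c)  e = here p
    go (miss p c) e = there (go c e)

  -- Multiplying `s₁ ⋯ sₖ` on the left by `s₁ ⋯ sᵢ ⋯ s₁` cancels the first `i` letters and puts back
  -- all of them but `sᵢ`.
  Any-N⇒Deletes : ∀ t w → Any (_≈ t) (N w) → ∃ λ w' → Deletes w' w × t ++ w ≈ w'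
  Any-N⇒Deletes t (s ∷ w) (here p) = w , here ,
    ≈-trans (++-congʳ (s ∷ w) (≈-sym p)) (∷-∷-cancel s w)
  Any-N⇒Deletes t (s ∷ w) (there a)
    with Any-N⇒Deletes (conj s t) w (Any.map (conj-adjoint s) (Any.map⁻ a))
  ... | w' , d , p = s ∷ w' , there d ,
    ∷-flip s (subst (_≈ w') (cong (s ∷_) (++-assoc t [ s ] w)) p)

  -- If `s` had an odd count in `N x`, then `s x` would equal `x` with a letter deleted and not be
  -- reduced. So the count is even in `N x`, odd in `N (s ∷ x)`, and odd in `N c` by invariance.
  odd-occurrence : ∀ {s x c} → Reduced (s ∷ x) → s ∷ x ≈ c → ¬ ¬ Any (_≈ [ s ]) (N c)
  odd-occurrence {s} {x} {c} red p k =
    count-total [ s ] (N c) λ (b , C) → count-total [ s ] (N x) λ where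
      (true , C') → let x' , d , q = Any-N⇒Deletes [ s ] x (count-true⇒Any C') in
        <⇒≱ (subst (length x' <_) (sym (cong suc (length-Deletes d))) (m<n⇒m<1+n ≤-refl)) (red x' (≈-sym q))
      (false , C') →
        k (count-true⇒Any (subst (Count _ _) (sym (count-~ (N-≈ p)
             (hit ≈-refl (count-map-conj s (count-cong (≈-sym (conj-generator s)) C'))) C)) C))

  exchange : ∀ {s x c} → Reduced (s ∷ x) → s ∷ x ≈ c → ¬ ¬ (∃ λ c' → Deletes c' c × c' ≈ x)
  exchange {s} {x} {c} red p k = odd-occurrence red p λ a →
    let c' , d , q = Any-N⇒Deletes [ s ] c a in
    k (c' , d , ≈-trans (≈-sym q) (≈-sym (∷-flip s p)))

-- Descents and the word problem

module ReducedWords {n} (M : CoxeterMatrix n) where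
  open Words M
  open Reflections M
  open NumbersGame M using (alt-≉)

  Descent : Fin n → Word n → Set
  Descent s w = ∃ λ x → Reduced (s ∷ x) × s ∷ x ≈ w

  reduced-≈ : ∀ {u w} → Reduced w → u ≈ w → length u ≤ length w → Reduced u
  reduced-≈ red p l v q = ≤-trans l (red v (≈-trans q p))

  reduced-length : ∀ {u v} → Reduced u → Reduced v → u ≈ v → length u ≡ length v
  reduced-length ru rv p = ≤-antisym (ru _ (≈-sym p)) (rv _ p)

  reduced-suffix : ∀ u {v} → Reduced (u ++ v) → Reduced v
  reduced-suffix u {v} red y p = +-cancelˡ-≤ (length u) _ _
    (subst₂ _≤_ (length-++ u) (length-++ u) (red (u ++ y) (++-congˡ u p)))

  reduced-[] : Reduced []
  reduced-[] v p = z≤n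

  ++-cancelʳ : ∀ w {u v} → u ++ w ≈ v ++ w → u ≈ v
  ++-cancelʳ w {u} {v} p = subst₂ _≈_ (reverse-involutive u) (reverse-involutive v) (reverse-cong
    (++-cancelˡ (reverse w) (subst₂ _≈_ (reverse-++ u w) (reverse-++ v w) (reverse-cong p))))

  parity-length : ∀ (u v : Word n) → length u ≡ length v → parity u ≡ parity v
  parity-length []      []      e = refl
  parity-length (s ∷ u) (t ∷ v) e = cong not (parity-length u v (suc-injective e))

  -- Parity excludes a word for `s w` as long as `w`, and a shorter one `v` would give the reduced
  -- expression `s v` of `w`.
  reduced-∷ : ∀ {s w} → Reduced w → ¬ Descent s w → Reduced (s ∷ w)
  reduced-∷ {s} {w} red nd v p with suc (length w) ≤? length v
  ... | yes q = q
  ... | no ¬q = contradiction (v , reduced-≈ red (≈-sym w≈) v<w , ≈-sym w≈) nd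
    where
    w≈ : w ≈ s ∷ v
    w≈ = ∷-flip s (≈-sym p)
    v<w : length v < length w
    v<w = ≤∧≢⇒< (≤-pred (≰⇒> ¬q)) λ e →
      Bool.not-¬ (sym (parity-length v w e)) (parity-cong w≈)

  deletes⇒¬reduced : ∀ {s w w'} → Deletes w' w → w' ≈ s ∷ w → ¬ Reduced (s ∷ w)
  deletes⇒¬reduced {w' = w'} d p red =
    <⇒≱ (subst (length w' <_) (sym (cong suc (length-Deletes d))) (m<n⇒m<1+n ≤-refl)) (red w' p)

  reduced-singleton : ∀ s → Reduced [ s ]
  reduced-singleton s = reduced-∷ reduced-[] λ (x , r , p) → <⇒≱ (s≤s z≤n) (r [] (≈-sym p))

  reduced-++ : ∀ z {x y} → Reduced (z ++ y) → Reduced x → x ≈ y → Reduced (z ++ x)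
  reduced-++ z {x} {y} rzy rx p = reduced-≈ rzy (++-congˡ z p)
    (subst₂ _≤_ (sym (length-++ z)) (sym (length-++ z)) (+-monoʳ-≤ (length z) (rx y (≈-sym p))))

  -- When s z' y arises from z' y' by the exchange condition, the letter deleted cannot lie
  -- in z', as s z' is reduced; so it lies in y'.
  factor : ∀ {J : Fin n → Set} {w} → Reduced w → (∀ s → J s → Descent s w) →
           ∀ z → All J z → Reduced z → ¬ ¬ (∃ λ y → Reduced (z ++ y) × z ++ y ≈ w)
  factor {w = w} red desc []      []         rz k = k (w , red , ≈-refl)
  factor {w = w} red desc (s ∷ z) (js ∷ jz) rz k =
    factor red desc z jz (reduced-suffix [ s ] rz) λ (y , rzy , zy≈w) →
    let x , rsx , sx≈w = desc s js in
    exchange rsx (≈-trans sx≈w (≈-sym zy≈w)) λ (c , d , c≈x) → case y zy≈w rzy (≈-trans (∷-cong s c≈x) sx≈w) (Deletes-++ z d)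
    where
    case : ∀ {c} y → z ++ y ≈ w → Reduced (z ++ y) → s ∷ c ≈ w →
           (∃ λ z' → Deletes z' z × c ≡ z' ++ y) ⊎ (∃ λ y' → Deletes y' y × c ≡ z ++ y') → ⊥
    case y zy≈w rzy sc≈w (inj₁ (z' , d , refl)) =
      deletes⇒¬reduced d (∷-flip s (++-cancelʳ y {s ∷ z'} (≈-trans sc≈w (≈-sym zy≈w)))) rz
    case y zy≈w rzy sc≈w (inj₂ (y' , d , refl)) =
      k (y' , reduced-≈ red sc≈w (≤-trans (≤-reflexive len) (rzy w (≈-sym zy≈w))) , sc≈w)
      where
      len : suc (length (z ++ y')) ≡ length (z ++ y)
      len = trans (cong suc (length-++ z)) (trans (sym (+-suc (length z) (length y')))
              (trans (cong (length z +_) (sym (length-Deletes d))) (sym (length-++ z))))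

  WithinOrder : Fin n → Fin n → ℕ → Set
  WithinOrder s t k = m s t ≡ 0 ⊎ k ≤ m s t

  order-swap : ∀ {s t k} → WithinOrder s t k → WithinOrder t s k
  order-swap {s} {t} {k} = subst (λ x → x ≡ 0 ⊎ k ≤ x) (CoxeterMatrix.symm M s t)

  order-pred : ∀ {s t k} → WithinOrder s t (suc k) → WithinOrder s t k
  order-pred (inj₁ p) = inj₁ p
  order-pred (inj₂ p) = inj₂ (≤-trans (n≤1+n _) p)

  Any-N-alt : ∀ {P : Word n → Set} s t k → Any P (N (alt s t k)) → ∃ λ i → i < k × P (alt s t (suc (i + i)))
  Any-N-alt {P} s t (suc k) a with Any.++⁻ (N (alt s t k)) (subst (Any P) (N-alt s t k) a)
  ... | inj₂ (here p) = k , ≤-refl , p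
  ... | inj₁ b with Any-N-alt s t k b
  ...   | i , i<k , p = i , m<n⇒m<1+n i<k , p

  -- If prefixing `s` fails, then `s` is a reflection of `t s …`, an odd alternating word with
  -- `2 i + 1` letters. Hence `(s t)^(i + 1) = 1`, with `i + 1` below the order, against `alt-≉`.
  alt-reduced : ∀ {s t} → s ≢ t → ∀ k → WithinOrder s t k → Reduced (alt s t k)
  alt-reduced s≢t zero    o = reduced-[]
  alt-reduced {s} {t} s≢t (suc k) o =
    reduced-∷ (alt-reduced (≢-sym s≢t) k (order-swap (order-pred o))) λ (x , red , p) →
    odd-occurrence red p λ a → absurd (Any-N-alt t s k a)
    where
    absurd : (∃ λ i → i < k × alt t s (suc (i + i)) ≈ [ s ]) → ⊥
    absurd (i , i<k , p) = alt-≉ s≢t i (order o)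
      (++-reverse⇒≈ _ _ (subst (_≈ []) (trans (cong (λ x → alt s t (suc x)) (sym (+-suc i i))) (alt-double s t (suc i)))
        (≈-trans (∷-cong s p) (∷-∷-cancel s []))))
      where
      order : WithinOrder s t (suc k) → m s t ≡ 0 ⊎ suc i < m s t
      order (inj₁ q) = inj₁ q
      order (inj₂ q) = inj₂ (≤-trans (s≤s i<k) q)

  All-alt : ∀ {P : Fin n → Set} {s t} → P s → P t → ∀ k → All P (alt s t k)
  All-alt p q zero    = []
  All-alt p q (suc k) = p ∷ All-alt q p k

  two-descents : ∀ {s t w} → Reduced w → Descent s w → Descent t w → ∀ r → r ≡ s ⊎ r ≡ t → Descent r w
  two-descents red ds dt r (inj₁ refl) = ds
  two-descents red ds dt r (inj₂ refl) = dt

  alt-factor : ∀ {s t w} → s ≢ t → Reduced w → Descent s w → Descent t w → ∀ k → WithinOrder s t k →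
               ¬ ¬ (∃ λ y → Reduced (alt s t k ++ y) × alt s t k ++ y ≈ w)
  alt-factor s≢t red ds dt k o = factor red (two-descents red ds dt) (alt _ _ k)
    (All-alt (inj₁ refl) (inj₂ refl) k) (alt-reduced s≢t k o)

  order-suc : ∀ {s t k} → m s t ≢ k → WithinOrder s t k → WithinOrder s t (suc k)
  order-suc ¬e (inj₁ q) = inj₁ q
  order-suc ¬e (inj₂ q) = inj₂ (≤∧≢⇒< q (≢-sym ¬e))

  -- The prefix is a whole side of the braid relation, and the other side begins with `s`.
  full : ∀ {s t w k z} → s ≢ t → m t s ≡ suc k → Reduced (alt t s (suc k) ++ z) →
         alt t s (suc k) ++ z ≈ w → Descent s w
  full {s} {t} {w} {k} {z} s≢t e rz z≈w =
    alt t s k ++ z , reduced-≈ rz braided (≤-reflexive same-length) , ≈-trans braided z≈w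
    where
    braided : alt s t (suc k) ++ z ≈ alt t s (suc k) ++ z
    braided = ++-congʳ z (≈-sym (subst (λ j → alt t s j ≈ alt s t j) e
      (alt-braid t s λ q → contradiction (trans (sym e) q) λ ())))
    same-length : length (alt s t (suc k) ++ z) ≡ length (alt t s (suc k) ++ z)
    same-length = trans (length-alt-++ s t (suc k) z) (sym (length-alt-++ t s (suc k) z))

  -- With both descents, an alternating prefix one letter longer would split off. Cancelling the
  -- common letters makes its last letter a descent of `z`, which the reducedness hypothesis on `z`
  -- excludes.
  stuck : ∀ {s t w} → s ≢ t → Reduced w → Descent t w → ∀ k z → WithinOrder t s (suc (suc k)) →
          Reduced (letter t s (suc k) ∷ z) → alt t s (suc k) ++ z ≈ w → ¬ Descent s w
  stuck {s} {t} s≢t red dt k z o rz' z≈w ds =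
    alt-factor (≢-sym s≢t) red dt ds (suc (suc k)) o λ (y , ry , y≈w) →
    let u    = alt t s (suc k)
        snoc = alt-∷ʳ-++ t s (suc k) y
        uy≈uz = ≈-trans (≈-reflexive snoc) (≈-trans y≈w (≈-sym z≈w))
        z<y  = rz' y (∷-flip _ (++-cancelˡ u uy≈uz))
        y≤z  = +-cancelˡ-≤ (length u) _ _ (subst₂ _≤_ (trans (cong length (sym snoc)) (length-++ u)) (length-++ u)
                 (ry (u ++ z) (≈-trans z≈w (≈-sym y≈w))))
    in <⇒≱ (≤-trans (n≤1+n _) (s≤s z<y)) y≤z

  -- Whether s is a left descent of w is decided by stripping from w, with first letter
  -- t ≠ s, the longest possible prefix t s t …: s is a descent iff it has m t s letters.
  descent? : ∀ N w → length w ≤ N → Reduced w → ∀ s → Descent s w ⊎ Reduced (s ∷ w)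
  strip : ∀ N {s t w} → s ≢ t → Reduced w → Descent t w → ∀ k z → length z ≤ N → WithinOrder t s (suc k) →
          Reduced (alt t s (suc k) ++ z) → alt t s (suc k) ++ z ≈ w → Descent s w ⊎ Reduced (s ∷ w)

  descent? N [] l red s = inj₂ (reduced-singleton s)
  descent? (suc N) (t ∷ y) (s≤s l) red s with s ≟ t
  ... | yes refl = inj₁ (y , red , ≈-refl)
  ... | no s≢t = strip N s≢t red (y , red , ≈-refl) 0 y l one red ≈-refl
    where
    one : WithinOrder t s 1
    one with m t s in e
    ... | zero  = inj₁ refl
    ... | suc _ = inj₂ (s≤s z≤n)

  strip N {s} {t} s≢t red dt k z l o rz z≈w with m t s ≟ℕ suc k
  ... | yes e = inj₁ (full s≢t e rz z≈w)
  -- Whether the prefix can be prolonged is a descent question about the shorter remainder `z`.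
  ... | no ¬e with descent? N z l (reduced-suffix (alt t s (suc k)) rz) (letter t s (suc k))
  ...   | inj₂ rz' = inj₂ (reduced-∷ red (stuck s≢t red dt k z (order-suc ¬e o) rz' z≈w))
  strip zero s≢t red dt k z l o rz z≈w | no ¬e | inj₁ (z' , rz' , z'≈z) =
    contradiction (≤-trans (rz' z (≈-sym z'≈z)) l) λ ()
  strip (suc N) {s} {t} s≢t red dt k z l o rz z≈w | no ¬e | inj₁ (z' , rz' , z'≈z) =
    strip N s≢t red dt (suc k) z' (≤-pred (≤-trans (rz' z (≈-sym z'≈z)) l)) (order-suc ¬e o)
      (subst Reduced (alt-∷ʳ-++ t s (suc k) z')
        (reduced-++ u rz rz' z'≈z))
      (≈-trans (≈-reflexive (sym (alt-∷ʳ-++ t s (suc k) z'))) (≈-trans p z≈w))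
    where
    u = alt t s (suc k)
    p : u ++ letter t s (suc k) ∷ z' ≈ u ++ z
    p = ++-congˡ u z'≈z

  descent : ∀ s {w} → Reduced w → Descent s w ⊎ Reduced (s ∷ w)
  descent s {w} red = descent? (length w) w ≤-refl red s

  reduce : ∀ w → ∃ λ r → Reduced r × r ≈ w
  reduce [] = [] , reduced-[] , ≈-refl
  reduce (s ∷ w) with reduce w
  ... | r , red , r≈w with descent s red
  ...   | inj₂ red' = s ∷ r , red' , ∷-cong s r≈w
  ...   | inj₁ (x , rx , p) = x , reduced-suffix [ s ] rx , ≈-trans (∷-flip s p) (∷-cong s r≈w)

  infix 4 _≈?_
  _≈?_ : ∀ u v → Dec (u ≈ v)
  u ≈? v with reduce (u ++ reverse v)
  ... | []    , _   , p = yes (++-reverse⇒≈ u v (≈-sym p))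
  ... | s ∷ r , red , p = no λ q → <⇒≱ (s≤s z≤n) (red [] (≈-sym (≈-trans p (≈⇒++-reverse q))))

-- Subwords and minimal coset representatives

All-reverse : ∀ {A : Set} {P : A → Set} xs → All P xs → All P (reverse xs)
All-reverse {P = P} xs ps = All.tabulate (All.lookup ps ∘ Any.reverse⁻)

-- A search among finitely many deletions turns the doubly negated exchange condition into an actual
-- deletion.
deletion? : ∀ {A : Set} {P : List A → Set} → (∀ c → Dec (P c)) → ∀ c → Dec (∃ λ c' → Deletes c' c × P c')
deletion? P? []      = no λ { (_ , () , _) }
deletion? P? (s ∷ c) = map′
  [ (λ p → c , here , p) , (λ (c' , d , p) → s ∷ c' , there d , p) ]′
  (λ { (_ , here , p) → inj₁ p ; (_ , there d , p) → inj₂ (_ , d , p) })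
  (P? c ⊎-dec deletion? (λ c' → P? (s ∷ c')) c)

module Subwords {n} (M : CoxeterMatrix n) where
  open Words M
  open Reflections M
  open ReducedWords M

  -- The deletion property: when `s` is a descent of the reduced subword `c` found so far, `s` is
  -- dropped together with the letter of `c` that exchange deletes.
  reduced-subword : ∀ w → ∃ λ c → c ⊆ w × Reduced c × c ≈ w
  reduced-subword [] = [] , [] , reduced-[] , ≈-refl
  reduced-subword (s ∷ w) with reduced-subword w
  ... | c , c⊆w , red , c≈w with descent s red
  ...   | inj₂ red' = s ∷ c , refl ∷ c⊆w , red' , ∷-cong s c≈w
  ...   | inj₁ (x , rx , sx≈c) with deletion? (λ c' → c' ≈? x) c
  ...     | no ¬d = contradiction ¬d (exchange rx sx≈c)
  ...     | yes (c' , d , c'≈x) =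
    c' , s ∷ʳ ⊆-trans (Deletes⇒⊆ d) c⊆w ,
    reduced-≈ (reduced-suffix [ s ] rx) c'≈x
      (≤-pred (≤-reflexive (trans (sym (length-Deletes d)) (sym (reduced-length rx red sx≈c))))) ,
    ≈-trans c'≈x (≈-trans (∷-flip s sx≈c) (∷-cong s c≈w))

  -- x is the product of some subword of y.
  Below : Word n → Word n → Set
  Below []      x = [] ≈ x
  Below (s ∷ y) x = Below y x ⊎ Below y (s ∷ x)

  below-cong : ∀ y {x x'} → x ≈ x' → Below y x → Below y x'
  below-cong []      p q        = ≈-trans q p
  below-cong (s ∷ y) p (inj₁ q) = inj₁ (below-cong y p q)
  below-cong (s ∷ y) p (inj₂ q) = inj₂ (below-cong y (∷-cong s p) q)

  below? : ∀ y x → Dec (Below y x)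
  below? []      x = [] ≈? x
  below? (s ∷ y) x = below? y x ⊎-dec below? y (s ∷ x)

  below⇒subword : ∀ y {x} → Below y x → ∃ λ c → c ⊆ y × c ≈ x
  below⇒subword []      p = [] , [] , p
  below⇒subword (s ∷ y) (inj₁ p) = let c , q , e = below⇒subword y p in c , s ∷ʳ q , e
  below⇒subword (s ∷ y) (inj₂ p) = let c , q , e = below⇒subword y p in s ∷ c , refl ∷ q , ≈-sym (∷-flip s (≈-sym e))

  subword⇒below : ∀ {c y} → c ⊆ y → ∀ {x} → c ≈ x → Below y x
  subword⇒below []         p = p
  subword⇒below (s ∷ʳ q)   p = inj₁ (subword⇒below q p)
  subword⇒below (refl ∷ q) p = inj₂ (subword⇒below q (∷-flip _ p))

  below-∷ : ∀ {s a b} → (∀ {x} → Below a x → Below b x) → ∀ {x} → Below (s ∷ a) x → Below (s ∷ b) x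
  below-∷ f = Sum.map f f

  below-++⁻ : ∀ u {z x} → Below (u ++ z) x → ∃₂ λ c e → Below u c × Below z e × c ++ e ≈ x
  below-++⁻ [] {x = x} p = [] , x , ≈-refl , p , ≈-refl
  below-++⁻ (s ∷ u) (inj₁ p) = let c , e , q , r , ce = below-++⁻ u p in c , e , inj₁ q , r , ce
  below-++⁻ (s ∷ u) (inj₂ p) = let c , e , q , r , ce = below-++⁻ u p in
    s ∷ c , e , inj₂ (below-cong u (≈-sym (∷-∷-cancel s c)) q) , r , ≈-sym (∷-flip s (≈-sym ce))

  below-++⁺ : ∀ u {z c e x} → Below u c → Below z e → c ++ e ≈ x → Below (u ++ z) x
  below-++⁺ [] {z} {e = e} p q ce = below-cong z (≈-trans (++-congʳ e p) ce) q
  below-++⁺ (s ∷ u) (inj₁ p) q ce = inj₁ (below-++⁺ u p q ce)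
  below-++⁺ (s ∷ u) (inj₂ p) q ce = inj₂ (below-++⁺ u p q (∷-cong s ce))

  below-[] : ∀ y → Below y []
  below-[] []      = ≈-refl
  below-[] (s ∷ y) = inj₁ (below-[] y)

  -- Prefixing a letter to an alternating word prolongs it or cancels its first letter. The strict
  -- bound for words that begin with `t` holds because the initial `s` is then lost.
  below-alt⁻ : ∀ s t k {c} → Below (alt s t k) c →
               (∃ λ j → j ≤ k × alt s t j ≈ c) ⊎ (∃ λ j → j < k × alt t s j ≈ c)
  below-alt⁻ s t zero    p = inj₁ (0 , z≤n , p)
  below-alt⁻ s t (suc k) (inj₁ p) with below-alt⁻ t s k p
  ... | inj₁ (j , l , q) = inj₂ (j , s≤s l , q)
  ... | inj₂ (j , l , q) = inj₁ (j , ≤-trans (<⇒≤ l) (n≤1+n k) , q)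
  below-alt⁻ s t (suc k) (inj₂ p) with below-alt⁻ t s k p
  ... | inj₁ (j , l , q)     = inj₁ (suc j , s≤s l , ≈-sym (∷-flip s (≈-sym q)))
  ... | inj₂ (zero , l , q)  = inj₁ (1 , s≤s z≤n , ≈-sym (∷-flip s (≈-sym q)))
  ... | inj₂ (suc j , l , q) = inj₂ (j , <-trans (n<1+n j) (m<n⇒m<1+n l) , ∷-cancel s q)

  below-alt⁺ : ∀ s t {k j} → j ≤ k → Below (alt s t k) (alt s t j)
  below-alt⁺ s t {k} z≤n = below-[] (alt s t k)
  below-alt⁺ s t (s≤s {j} {k} l) = inj₂ (below-cong (alt t s k) (≈-sym (∷-∷-cancel s (alt t s j))) (below-alt⁺ t s l))

  below-alt-swap : ∀ s t {k j} → j < k → Below (alt t s k) (alt s t j)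
  below-alt-swap s t (s≤s l) = inj₁ (below-alt⁺ s t l)

  below-alt-braid : ∀ {s t k} → alt s t k ≈ alt t s k → ∀ {c} → Below (alt s t k) c → Below (alt t s k) c
  below-alt-braid {s} {t} {k} braid-st p with below-alt⁻ s t k p
  ... | inj₂ (j , l , q) = below-cong (alt t s k) q (below-alt⁺ t s (<⇒≤ l))
  ... | inj₁ (j , l , q) with m≤n⇒m<n∨m≡n l
  ...   | inj₁ l'   = below-cong (alt t s k) q (below-alt-swap s t l')
  -- The full-length word is the only one that does not fit as a subword; here the braid relation
  -- itself is used.
  ...   | inj₂ refl = below-cong (alt t s k) (≈-trans (≈-sym braid-st) q) (below-alt⁺ t s ≤-refl)

  below-braid : ∀ {s t k} → alt s t k ≈ alt t s k → ∀ z {x} → Below (alt s t k ++ z) x → Below (alt t s k ++ z) x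
  below-braid {s} {t} {k} braid-st z p = let c , e , q , r , ce = below-++⁻ (alt s t k) p in
    below-++⁺ (alt t s k) (below-alt-braid braid-st q) r ce

  -- Matsumoto's argument: words with first letters s ≠ t are both compared with words that
  -- begin with a side of the braid relation of s and t.
  below-reduced : ∀ N {y y'} → length y ≤ N → Reduced y → Reduced y' → y ≈ y' → ∀ {x} → Below y x → Below y' x
  below-reduced N {[]} {[]} l ry ry' e p = p
  below-reduced N {[]} {t ∷ b} l ry ry' e p = contradiction (ry' [] e) λ ()
  below-reduced N {s ∷ a} {[]} l ry ry' e p = contradiction (ry [] (≈-sym e)) λ ()
  below-reduced (suc N) {s ∷ a} {t ∷ b} (s≤s l) ry ry' e {x} p with s ≟ t
  ... | yes refl = below-∷ {s} (below-reduced N l (reduced-suffix [ s ] ry) (reduced-suffix [ s ] ry') (∷-cancel s e)) p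
  ... | no s≢t = decidable-stable (below? (t ∷ b) x) λ k → split k (m s t) refl
    where
    ds : Descent s (s ∷ a)
    ds = a , ry , ≈-refl
    dt : Descent t (s ∷ a)
    dt = b , ry' , ≈-sym e
    split : ¬ Below (t ∷ b) x → ∀ k → m s t ≡ k → ⊥
    -- For infinite order an alternating prefix longer than the whole reduced word would split off.
    split ¬p zero e₀ = alt-factor s≢t ry ds dt K (inj₁ e₀) λ (z , rz , z≈) →
      <⇒≱ (≤-trans (m≤m+n K (length z)) (≤-reflexive (sym (length-alt-++ s t K z))))
          (rz (s ∷ a) (≈-sym z≈))
      where K = suc (length (s ∷ a))
    split ¬p (suc k) eₖ = alt-factor s≢t ry ds dt (suc k) (inj₂ (≤-reflexive (sym eₖ))) λ (z , rz , z≈) →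
      let braid-st = subst (λ j → alt s t j ≈ alt t s j) eₖ (alt-braid s t λ e₀ → contradiction (trans (sym e₀) eₖ) λ ())
          same-length = trans (length-alt-++ t s (suc k) z) (sym (length-alt-++ s t (suc k) z))
          braided = ++-congʳ z (≈-sym braid-st)
          rz' = reduced-≈ rz braided (≤-reflexive same-length)
          b≈  = ≈-trans braided (≈-trans z≈ e)
          len = ≤-pred (≤-trans (rz' (s ∷ a) (≈-sym (≈-trans braided z≈))) (s≤s l))
      in ¬p (below-∷ {t} (below-reduced N len (reduced-suffix [ t ] rz') (reduced-suffix [ t ] ry') (∷-cancel t b≈))
               (below-braid {s} {t} {suc k} braid-st z
                 (below-∷ {s} (below-reduced N l (reduced-suffix [ s ] ry) (reduced-suffix [ s ] rz) (∷-cancel s (≈-sym z≈))) p)))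

  -- A lifting property: exchange deletes one letter from a subword of `y` with product `s x`, which
  -- leaves a subword with product `x`.
  below-lift : ∀ y {s x} → Reduced (s ∷ x) → Below y (s ∷ x) → Below y x
  below-lift y {s} {x} red p = decidable-stable (below? y x) λ k →
    let c , c⊆y , c≈ = below⇒subword y p in
    exchange red (≈-sym c≈) λ (c' , d , c'≈x) →
    k (subword⇒below (⊆-trans (Deletes⇒⊆ d) c⊆y) c'≈x)

  -- If the subword uses the first letter of `z`, that letter cancels; otherwise lifting removes it
  -- from the product.
  below-cancel : ∀ z {y x} → Reduced (z ++ x) → Below (z ++ y) (z ++ x) → Below y x
  below-cancel []      red p        = p
  below-cancel (s ∷ z) {y} {x} red (inj₁ p) =
    below-cancel z (reduced-suffix [ s ] red) (below-lift (z ++ y) red p)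
  below-cancel (s ∷ z) {y} {x} red (inj₂ p) =
    below-cancel z (reduced-suffix [ s ] red) (below-cong (z ++ y) (∷-∷-cancel s (z ++ x)) p)

  module _ {J : Fin n → Set} where

    -- A used letter `s` turns the product into `s x`, which is reduced, so lifting leads back to
    -- `x`.
    below-drop : ∀ {z y x} → All J z → (∀ s → J s → Reduced (s ∷ x)) → Below (z ++ y) x → Below y x
    below-drop []       red p        = p
    below-drop (_ ∷ jz) red (inj₁ p) = below-drop jz red p
    below-drop {s ∷ z} {y} (js ∷ jz) red (inj₂ p) = below-drop jz red (below-lift (z ++ y) (red s js) p)

    Minimal : Word n → Set
    Minimal x = ∀ g → All J g → ∀ v → v ≈ g ++ x → length x ≤ length v

    -- By induction on `z`, exchange would delete a letter of `z` or of `x`. The first contradicts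
    -- reducedness of `z`; the second gives a shorter member of the coset `W_J x`.
    minimal⇒reduced : ∀ {x} → Minimal x → ∀ z → All J z → Reduced z → Reduced (z ++ x)
    minimal⇒reduced     min []      jz        rz v p = min [] [] v p
    minimal⇒reduced {x} min (s ∷ z) (js ∷ jz) rz =
      reduced-∷ (minimal⇒reduced min z jz (reduced-suffix [ s ] rz)) λ (y , ry , e) →
      exchange ry e λ (c , d , c≈y) → case (≈-trans (∷-cong s c≈y) e) (Deletes-++ z d)
      where
      case : ∀ {c} → s ∷ c ≈ z ++ x →
             (∃ λ z' → Deletes z' z × c ≡ z' ++ x) ⊎ (∃ λ x' → Deletes x' x × c ≡ z ++ x') → ⊥
      case e (inj₁ (z' , d , refl)) = deletes⇒¬reduced d (∷-flip s (++-cancelʳ x {s ∷ z'} e)) rz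
      case e (inj₂ (x' , d , refl)) = <⇒≱ (≤-reflexive (sym (length-Deletes d)))
        (min (reverse z ++ s ∷ z) (All.++⁺ (All-reverse z jz) (js ∷ jz)) x'
          (≈-trans (≈-sym (inverseˡ z x')) (≈-trans (++-congˡ (reverse z) (∷-flip s e))
            (≈-reflexive (sym (++-assoc (reverse z) (s ∷ z) x))))))

    minimal-representative : ∀ N x → length x ≤ N →
                             ¬ ¬ (∃₂ λ g x₀ → All J g × Minimal x₀ × g ++ x₀ ≈ x)
    minimal-representative N [] l k = k ([] , [] , [] , (λ _ _ _ _ → z≤n) , ≈-refl)
    minimal-representative zero (s ∷ x) ()
    minimal-representative (suc N) x l k = ¬¬-excluded-middle λ where
      (yes min) → k ([] , x , [] , min , ≈-refl)
      (no ¬min) → ¬min λ g jg v v≈ → decidable-stable (length x ≤? length v) λ x≰v →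
        minimal-representative N v (≤-pred (≤-trans (≰⇒> x≰v) l)) λ (h , x₀ , jh , min , e) →
        k (reverse g ++ h , x₀ , All.++⁺ (All-reverse g jg) jh , min ,
           ≈-trans (≈-reflexive (++-assoc (reverse g) h x₀)) (≈-trans (++-congˡ (reverse g) (≈-trans e v≈)) (inverseˡ g x)))

    -- Write `x` as a reduced word `c` over `J` times a minimal representative. The first letter of
    -- a nonempty `c` would be a descent of `x` in `J`.
    no-descents⇒minimal : ∀ {x} → Reduced x → (∀ s → J s → Reduced (s ∷ x)) → Minimal x
    no-descents⇒minimal {x} red nd g jg v v≈ = decidable-stable (length x ≤? length v) λ k →
      minimal-representative (length x) x ≤-refl λ (h , x₀ , jh , min , hx₀≈x) →
      let c , c⊆h , rc , c≈h = reduced-subword h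
          jc = All-resp-⊆ c⊆h jh
      in case k x₀ min c jc (minimal⇒reduced min c jc rc) (≈-trans (++-congʳ x₀ c≈h) hx₀≈x)
      where
      case : ¬ length x ≤ length v → ∀ x₀ → Minimal x₀ → ∀ c → All J c → Reduced (c ++ x₀) → c ++ x₀ ≈ x → ⊥
      case k x₀ min [] _ r e = k (≤-trans (red x₀ e) (min g jg v (≈-trans v≈ (++-congˡ g (≈-sym e)))))
      case k x₀ min (s ∷ c) (js ∷ _) r e =
        <⇒≱ (≤-trans (n≤1+n _) (s≤s (nd s js (c ++ x₀) (∷-flip s e)))) (r x (≈-sym e))

    no-descents⇒reduced-++ : ∀ {x z} → Reduced x → (∀ s → J s → Reduced (s ∷ x)) → All J z → Reduced z → Reduced (z ++ x)
    no-descents⇒reduced-++ {z = z} red nd = minimal⇒reduced (no-descents⇒minimal red nd) z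

-- Fixed points

words≤ : ∀ {n} → ℕ → List (Word n)
words≤ zero    = [ [] ]
words≤ (suc N) = [] ∷ cartesianProductWith _∷_ (allFin _) (words≤ N)

∈-words≤ : ∀ {n} N (w : Word n) → length w ≤ N → w ∈ words≤ N
∈-words≤ zero    []      l       = here refl
∈-words≤ (suc N) []      l       = here refl
∈-words≤ (suc N) (s ∷ w) (s≤s l) = there (∈-cartesianProductWith⁺ _∷_ (∈-allFin s) (∈-words≤ N w l))

-- Membership in a `G`-orbit is not assumed decidable; this still provides the orbit as a `Subset`
-- inside a negated goal.
¬¬-comprehension : ∀ {n} (P : Fin n → Set) → ¬ ¬ (∃ λ (J : Subset n) → ∀ j → (j ∈ₛ J) ⇔ P j)
¬¬-comprehension {zero}  P k = k ([] , λ ())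
¬¬-comprehension {suc n} P k = ¬¬-comprehension (P ∘ suc) λ (J , f) → ¬¬-excluded-middle λ where
  (yes p) → k (inside ∷ J , λ where
    zero    → mk⇔ (λ _ → p) (λ _ → here)
    (suc j) → mk⇔ (λ { (there q) → Equivalence.to (f j) q }) (there ∘ Equivalence.from (f j)))
  (no ¬p) → k (outside ∷ J , λ where
    zero    → mk⇔ (λ ()) (λ p → contradiction p ¬p)
    (suc j) → mk⇔ (λ { (there q) → Equivalence.to (f j) q }) (there ∘ Equivalence.from (f j)))

module FixedPoints {n} (M : CoxeterMatrix n) (G : AutGroup M) where
  open Words M
  open ReducedWords M
  open Subwords M

  fixed-≈ : ∀ {w w'} → w ≈ w' → IsFixed G w → IsFixed G w'
  fixed-≈ p fix h hm = ≈-trans (fun-cong h (≈-sym p)) (≈-trans (fix h hm) p)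

  fun-letterwise : ∀ h x → ∃ λ x' → fun h x ≈ x' × length x' ≡ length x
  fun-letterwise h [] = [] , ≈-sym (++-cancelˡ (fun h []) (≈-trans (≈-reflexive (++-identityʳ _)) (fun-hom h [] []))) , refl
  fun-letterwise h (s ∷ x) = let x' , p , l = fun-letterwise h x ; t , q = fun-S h s in
    t ∷ x' , ≈-trans (fun-hom h [ s ] x) (++-cong q p) , cong suc l

  descent-fun : ∀ {w s t} → Reduced w → IsFixed G w → ∀ h → Mem G h → fun h [ s ] ≈ [ t ] → Descent s w → Descent t w
  descent-fun {w} {s} {t} red fix h hm hs (x , rx , p) =
    let x' , q , l = fun-letterwise h x
        e : t ∷ x' ≈ w
        e = ≈-trans (++-cong (≈-sym hs) (≈-sym q)) (≈-trans (≈-sym (fun-hom h [ s ] x)) (≈-trans (fun-cong h p) (fix h hm)))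
    in x' , reduced-≈ red e (≤-trans (≤-reflexive (cong suc l)) (rx w (≈-sym p))) , e

  -- The inverse of one group element carries `s` back to the base point of the orbit, and another
  -- carries that on to `t`.
  descent-orbit : ∀ {J w s} → IsOrbit G J → Reduced w → IsFixed G w → s ∈ₛ J → Descent s w → ∀ t → t ∈ₛ J → Descent t w
  descent-orbit {s = s} (i , f) red fix s∈ ds t t∈ =
    let h , hm , p   = Equivalence.to (f s) s∈
        h' , hm' , q = Equivalence.to (f t) t∈
        h⁻ , h⁻m , r = inverse G h hm
        back = ≈-trans (r [ s ]) (≈-trans (inv-cong h (≈-sym p)) (inv-fun h [ i ]))
    in descent-fun red fix h' hm' q (descent-fun red fix h⁻ h⁻m back ds)

  -- By `factor`, every reduced word over `J` is a left factor of `w` with lengths adding, so its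
  -- length is bounded by that of `w`.
  descents⇒finite : ∀ {J w} → Reduced w → (∀ s → s ∈ₛ J → Descent s w) → FiniteParabolic M J
  descents⇒finite {J} {w} red ds = words≤ (length w) , λ u ju →
    let c , c⊆u , rc , c≈u = reduced-subword u in
    c , ∈-words≤ (length w) c (bound c rc (All-resp-⊆ c⊆u ju)) , c≈u
    where
    bound : ∀ c → Reduced c → OverJ J c → length c ≤ length w
    bound c rc jc = decidable-stable (length c ≤? length w) λ k →
      factor red ds c jc rc λ (y , ry , cy≈w) →
      k (≤-trans (≤-trans (m≤m+n (length c) (length y)) (≤-reflexive (sym (length-++ c)))) (ry w (≈-sym cy≈w)))

-- Reducedness and Bruhat comparison under φ

module Twisted {n} (M : CoxeterMatrix n) (G : AutGroup M) (D : TildeData M G) where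
  open Words M
  open ReducedWords M
  open Subwords M
  open FixedPoints M G
  private
    module T where
      open Words (M̃ D) public
      open ReducedWords (M̃ D) public
      open Subwords (M̃ D) public

    K : ℕ
    K = TildeData.k D

    Φ : Word K → Word n
    Φ = φ D

  Φ-fixed : ∀ u → IsFixed G (Φ u)
  Φ-fixed u = Equivalence.from (φ-image D (Φ u)) (u , ≈-refl)

  w₀-over : ∀ a → OverJ (orb D a) (w₀ D a)
  w₀-over a = proj₁ (w₀-longest D a)

  w₀-reduced : ∀ a → Reduced (w₀ D a)
  w₀-reduced a = proj₁ (proj₂ (w₀-longest D a))

  w₀-nonempty : ∀ a → 0 < length (w₀ D a)
  w₀-nonempty a =
    let i , f       = orb-orbit D a
        h , hm , id = has-id G
        u , p , l   = proj₂ (proj₂ (w₀-longest D a)) [ i ] (Equivalence.from (f i) (h , hm , id [ i ]) ∷ [])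
    in ≤-trans (reduced-singleton i u p) l

  w₀-involutive : ∀ a y → w₀ D a ++ w₀ D a ++ y ≈ y
  w₀-involutive a y = ≈-trans
    (≈-reflexive (trans (sym (++-assoc (w₀ D a) (w₀ D a) y))
      (cong (λ x → (w₀ D a ++ x) ++ y) (sym (++-identityʳ (w₀ D a))))))
    (++-congʳ y (φ-cong D (a ∷ a ∷ []) [] (T.∷-∷-cancel a [])))

  factor-w₀ : ∀ a u {r} → Reduced r → r ≈ Φ u → (∀ s → s ∈ₛ orb D a → Descent s r) →
              ¬ ¬ (∃ λ y → Reduced (w₀ D a ++ y) × w₀ D a ++ y ≈ r × y ≈ Φ (a ∷ u))
  factor-w₀ a u {r} red r≈ ds k = factor red ds (w₀ D a) (w₀-over a) (w₀-reduced a) λ (y , ry , e) →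
    k (y , ry , e , ≈-trans (≈-sym (w₀-involutive a y)) (++-congˡ (w₀ D a) (≈-trans e r≈)))

  -- Split off a whole w₀ J for the orbit J of a left descent, repeatedly.
  reduced-image : ∀ N u {r} → length r ≤ N → Reduced r → r ≈ Φ u → ¬ ¬ (∃ λ û → û T.≈ u × Reduced (Φ û))
  reduced-image N u {[]} l red r≈ k = k ([] , φ-inj D [] u r≈ , reduced-[])
  reduced-image (suc N) u {s ∷ r} l red r≈ k =
    -- `J` is the orbit of the first letter. As the element is fixed, all of `J` are descents; hence
    -- `W_J` is finite and `J` is one of the listed orbits.
    ¬¬-comprehension (λ j → ∃ λ h → Mem G h × fun h [ s ] ≈ [ j ]) λ (J , f) →
    let ds : ∀ t → t ∈ₛ J → Descent t (s ∷ r)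
        ds t t∈ = let h , hm , p = Equivalence.to (f t) t∈ in
                  descent-fun red (fixed-≈ (≈-sym r≈) (Φ-fixed u)) h hm p (r , red , ≈-refl)
    in step ds (orb-all D J (s , f) (descents⇒finite red ds))
    where
    step : ∀ {J} → (∀ t → t ∈ₛ J → Descent t (s ∷ r)) → (∃ λ a → orb D a ≡ J) → ⊥
    step ds (a , refl) = factor-w₀ a u red r≈ ds λ (y , ry , e , y≈) →
      let y<r : length y < length (s ∷ r)
          y<r = ≤-trans (+-monoˡ-≤ (length y) (w₀-nonempty a))
            (≤-trans (≤-reflexive (sym (length-++ (w₀ D a)))) (ry (s ∷ r) (≈-sym e)))
      in reduced-image N (a ∷ u) (≤-pred (≤-trans y<r l)) (reduced-suffix (w₀ D a) ry) y≈ λ (û , p , rû) →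
         k (a ∷ û , T.≈-sym (T.∷-flip a (T.≈-sym p)) ,
            reduced-++ (w₀ D a) ry rû (≈-trans (φ-cong D û (a ∷ u) p) (≈-sym y≈)))

  ⊆⇒length-Φ< : ∀ {c u} → c ⊆ u → c ≡ u ⊎ length (Φ c) < length (Φ u)
  ⊆⇒length-Φ< [] = inj₁ refl
  ⊆⇒length-Φ< {c} {a ∷ u} (_ ∷ʳ p) = inj₂ (≤-trans (s≤s (weak (⊆⇒length-Φ< p)))
    (≤-trans (+-monoˡ-≤ (length (Φ u)) (w₀-nonempty a)) (≤-reflexive (sym (length-++ (w₀ D a))))))
    where
    weak : c ≡ u ⊎ length (Φ c) < length (Φ u) → length (Φ c) ≤ length (Φ u)
    weak (inj₁ refl) = ≤-refl
    weak (inj₂ l)    = <⇒≤ l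
  ⊆⇒length-Φ< {a ∷ c} {a ∷ u} (refl ∷ p) with ⊆⇒length-Φ< p
  ... | inj₁ refl = inj₁ refl
  ... | inj₂ l    = inj₂ (subst₂ _<_ (sym (length-++ (w₀ D a))) (sym (length-++ (w₀ D a))) (+-monoʳ-< (length (w₀ D a)) l))

  -- A proper subword has a strictly shorter image, since each `w₀ D a` is nonempty. So a reduced
  -- subword for the element of `u` must be all of `u`.
  Φ-reduced⁻ : ∀ {u} → Reduced (Φ u) → T.Reduced u
  Φ-reduced⁻ {u} red with T.reduced-subword u
  ... | c , c⊆u , rc , c≈u with ⊆⇒length-Φ< c⊆u
  ...   | inj₁ refl = rc
  ...   | inj₂ l    = contradiction (red (Φ c) (φ-cong D c u c≈u)) (<⇒≱ l)

  -- One descent in the orbit would bring all of them and split `w₀ D a` off `Φ u`. The rest has a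
  -- reduced image word `û` for `a u`, and `a û` is then a reduced word for `u`, although `û` is
  -- longer than `u`.
  no-descent : ∀ {a u} → T.Reduced (a ∷ u) → Reduced (Φ u) → ∀ s → s ∈ₛ orb D a → Reduced (s ∷ Φ u)
  no-descent {a} {u} rau rΦ s s∈ = reduced-∷ rΦ λ ds →
    factor-w₀ a u rΦ ≈-refl (descent-orbit (orb-orbit D a) rΦ (Φ-fixed u) s∈ ds) λ (y , ry , e , y≈) →
    reduced-image (length y) (a ∷ u) ≤-refl (reduced-suffix (w₀ D a) ry) y≈ λ (û , p , rû) →
    let raû = Φ-reduced⁻ {a ∷ û} (reduced-++ (w₀ D a) ry rû (≈-trans (φ-cong D û (a ∷ u) p) (≈-sym y≈)))
    in <⇒≱ (≤-trans (s≤s (n≤1+n _)) (s≤s (rau û p))) (raû u (T.∷-flip a (T.≈-sym p)))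

  Φ-reduced : ∀ {u} → T.Reduced u → Reduced (Φ u)
  Φ-reduced {[]}    red = reduced-[]
  Φ-reduced {a ∷ u} red = no-descents⇒reduced-++ rΦ (no-descent red rΦ) (w₀-over a) (w₀-reduced a)
    where rΦ = Φ-reduced (T.reduced-suffix [ a ] red)

  -- If `a` is a descent of `u`, then `w₀ D a` cancels on both sides. Otherwise `Φ û` has no descent
  -- in the orbit, and `w₀ D a` is dropped from the larger side only.
  below-Φ⁻ : ∀ v u → Below (Φ v) (Φ u) → T.Below v u
  below-Φ⁻ []      u p = φ-inj D [] u p
  below-Φ⁻ (a ∷ v) u p with T.reduce u
  ... | û , rû , û≈u with T.descent a rû
  ...   | inj₁ (x , rx , e) =
    inj₂ (T.below-cong v (T.≈-trans (T.∷-flip a e) (T.∷-cong a û≈u))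
      (below-Φ⁻ v x (below-cancel (w₀ D a) (Φ-reduced rx)
        (below-cong (Φ (a ∷ v)) (φ-cong D u (a ∷ x) (T.≈-sym (T.≈-trans e û≈u))) p))))
  ...   | inj₂ raû =
    inj₁ (T.below-cong v û≈u
      (below-Φ⁻ v û (below-drop (w₀-over a) (no-descent raû (Φ-reduced rû))
        (below-cong (Φ (a ∷ v)) (φ-cong D u û (T.≈-sym û≈u)) p))))

  Φ-⊆ : ∀ {c u} → c ⊆ u → Φ c ⊆ Φ u
  Φ-⊆ []         = []
  Φ-⊆ {c} (a ∷ʳ p) = ++⁺ (minimum (w₀ D a)) (Φ-⊆ p)
  Φ-⊆ (refl ∷ p) = ++⁺ ⊆-refl (Φ-⊆ p)

  bruhat-Φ⁺ : ∀ u v → Bruhat (M̃ D) u v → Bruhat M (Φ u) (Φ v)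
  bruhat-Φ⁺ u v (y , y≈v , ry , c , c⊆y , rc , c≈u) =
    Φ y , φ-cong D y v y≈v , Φ-reduced ry , Φ c , Φ-⊆ c⊆y , Φ-reduced rc , φ-cong D c u c≈u

  bruhat-Φ⁻ : ∀ u v → Bruhat M (Φ u) (Φ v) → Bruhat (M̃ D) u v
  bruhat-Φ⁻ u v (y , y≈Φv , ry , c , c⊆y , rc , c≈Φu) =
    let v̂ , rv̂ , v̂≈v = T.reduce v
        y≈Φv̂ = ≈-trans y≈Φv (φ-cong D v v̂ (T.≈-sym v̂≈v))
        -- The given reduced word `y` may fail to be a concatenation of words `w₀ D a`; comparison
        -- is moved to `Φ v̂`, which is one.
        b = below-reduced (length y) ≤-refl ry (Φ-reduced rv̂) y≈Φv̂ (subword⇒below c⊆y c≈Φu)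
        e , e⊆v̂ , e≈u = T.below⇒subword v̂ (below-Φ⁻ v̂ u b)
        e' , e'⊆e , re' , e'≈e = T.reduced-subword e
    in v̂ , v̂≈v , rv̂ , e' , ⊆-trans e'⊆e e⊆v̂ , re' , T.≈-trans e'≈e e≈u

theoremA1 : ∀ {n} (M : CoxeterMatrix n) (G : AutGroup M) (D : TildeData M G) →
    BruhatIso M G (M̃ D)
theoremA1 M G D = φ D , Φ-fixed , φ-cong D , φ-inj D ,
  (λ w → Equivalence.to (φ-image D w)) , λ u v → mk⇔ (bruhat-Φ⁺ u v) (bruhat-Φ⁻ u v)
  where open Twisted M G D
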